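{- Let $m>1$ be an integer that is not a prime power, with prime factorization $m=p_1^{e_1}p_2^{e_2}\cdots p_r^{e_r}$ ($r\ge 2$ distinct primes). There is a constant $c>0$ depending only on $m$ such that for every $n\ge 3$ the following holds. Let $X=\{x_{ij}\}$ be the $n\times n$ matrix whose entries are distinct indeterminates over $\mathbb{Z}_m$. Then there exist effectively computable constant $n\times t$ matrices $B$ and $C$ over $\mathbb{Z}_m$, where $$t\le \exp\Big(c\,\sqrt[r]{\log n\,(\log\log n)^{r-1}}\Big)\quad(\text{in particular } t=n^{o(1)}),$$ such that $B^TXB$ is a $t\times t$ matrix and the $n\times n$ matrix $CB^TXBC^T$ is a 1-a-strong representation of the matrix $X$ modulo $m$.
   Context: $\mathbb{Z}_m$ denotes the ring of integers modulo $m=p_1^{e_1}\cdots p_\ell^{e_\ell}$. For polynomials $f=\sum_I a_I x_I$ and $g=\sum_I b_I x_I$ over $\mathbb{Z}_m$ (sums over monomials $x_I$), $g$ is an alternative representation of $f$ modulo $m$ if for every monomial $I$ there is some $j$ with $a_I\equiv b_I \pmod{p_j^{e_j}}$; $g$ is a 1-a-strong representation of $f$ modulo $m$ if it is an alternative representation and, whenever $a_I\not\equiv b_I\pmod{p_i^{e_i}}$ for some $i$, then $a_I\equiv 0\pmod m$. A matrix $D=\{d_{ij}\}$ whose entries are polynomials in the indeterminates $\{x_{ij}\}$ is a 1-a-strong representation of the matrix $X=\{x_{ij}\}$ modulo $m$ if for all $1\le i,j\le n$ the polynomial $d_{ij}$ is a 1-a-strong representation of the polynomial $x_{ij}$ modulo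 $m$. -}

module Defs where

open import Level using (0ℓ)
open import Algebra.Bundles using (CommutativeRing)
open import Algebra.Bundles.Raw using (RawSemiring)
import Algebra.Definitions.RawSemiring as RawSemiringDefs
open import Data.Fin.Base using (Fin; combine)
open import Data.Integer.Base as ℤ using (ℤ; +_)
import Data.Integer.Properties as ℤₚ
open import Data.Integer.Divisibility.Signed using (_∣_; ∣-reflexive; ∣m∣n⇒∣m+n; ∣m⇒∣-m; ∣n⇒∣m*n; divides)
open import Data.Integer.Tactic.RingSolver using (solve-∀)
open import Data.List.Base using (List; []; _∷_; _++_; map; cartesianProductWith)
open import Data.Nat.Base as ℕ using (ℕ; zero; suc)
import Data.Nat.Properties as ℕₚ
open import Data.Nat.Primality using (Prime)
open import Data.Product.Base using (_×_; _,_; ∃-syntax)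
open import Data.Rational.Base as ℚ using (ℚ; 0ℚ; 1ℚ)
open import Data.Sum.Base using (_⊎_)
open import Data.Vec.Base as Vec using (Vec)
import Data.Vec.Properties as Vecₚ
open import Data.Vec.Functional as VecF using (Vector; foldr)
open import Function.Definitions using (Injective)
open import Relation.Binary.PropositionalEquality using (_≡_; refl; cong; subst)
open import Relation.Nullary using (¬_; yes; no)
open import Relation.Unary using (Pred; _∈_; _⊆_)

IsPrimePower : ℕ → Set
IsPrimePower m = ∃[ p ] ∃[ k ] Prime p × 1 ℕ.≤ k × m ≡ p ℕ.^ k

record PrimeFactorization (m r : ℕ) : Set where
  field
    p        : Fin r → ℕ
    e        : Fin r → ℕ
    prime    : ∀ i → Prime (p i)
    distinct : Injective _≡_ _≡_ p
    positive : ∀ i → 1 ℕ.≤ e i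
    product  : m ≡ foldr ℕ._*_ 1 (λ i → p i ℕ.^ e i)

-- ℤ_m as a setoid quotient: elements are integers, equality is congruence.

infix 4 _≡_[mod_]

_≡_[mod_] : ℤ → ℤ → ℕ → Set
a ≡ b [mod m ] = + m ∣ a ℤ.- b

module _ (m : ℕ) where
  private
    resp : ∀ {a b} → a ≡ b → + m ∣ a → + m ∣ b
    resp = subst (+ m ∣_)

    ≡⇒mod : ∀ {a b} → a ≡ b → a ≡ b [mod m ]
    ≡⇒mod {a} refl = resp (eq a) (divides (+ 0) refl)
      where
      eq : ∀ a → + 0 ≡ a ℤ.- a
      eq = solve-∀

    sym-mod : ∀ {a b} → a ≡ b [mod m ] → b ≡ a [mod m ]
    sym-mod {a} {b} h = resp (eq a b) (∣m⇒∣-m h)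
      where
      eq : ∀ a b → ℤ.- (a ℤ.- b) ≡ b ℤ.- a
      eq = solve-∀

    trans-mod : ∀ {a b c} → a ≡ b [mod m ] → b ≡ c [mod m ] → a ≡ c [mod m ]
    trans-mod {a} {b} {c} h k = resp (eq a b c) (∣m∣n⇒∣m+n h k)
      where
      eq : ∀ a b c → (a ℤ.- b) ℤ.+ (b ℤ.- c) ≡ a ℤ.- c
      eq = solve-∀

    +-cong-mod : ∀ {a b c d} → a ≡ b [mod m ] → c ≡ d [mod m ] →
                 a ℤ.+ c ≡ b ℤ.+ d [mod m ]
    +-cong-mod {a} {b} {c} {d} h k = resp (eq a b c d) (∣m∣n⇒∣m+n h k)
      where
      eq : ∀ a b c d → (a ℤ.- b) ℤ.+ (c ℤ.- d) ≡ (a ℤ.+ c) ℤ.- (b ℤ.+ d)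
      eq = solve-∀

    *-cong-mod : ∀ {a b c d} → a ≡ b [mod m ] → c ≡ d [mod m ] →
                 a ℤ.* c ≡ b ℤ.* d [mod m ]
    *-cong-mod {a} {b} {c} {d} h k =
      resp (eq a b c d) (∣m∣n⇒∣m+n (∣n⇒∣m*n c h) (∣n⇒∣m*n b k))
      where
      eq : ∀ a b c d → c ℤ.* (a ℤ.- b) ℤ.+ b ℤ.* (c ℤ.- d) ≡ a ℤ.* c ℤ.- b ℤ.* d
      eq = solve-∀

    neg-cong-mod : ∀ {a b} → a ≡ b [mod m ] → ℤ.- a ≡ ℤ.- b [mod m ]
    neg-cong-mod {a} {b} h = resp (eq a b) (∣m⇒∣-m h)
      where
      eq : ∀ a b → ℤ.- (a ℤ.- b) ≡ ℤ.- a ℤ.- ℤ.- b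
      eq = solve-∀

  ℤ/ : CommutativeRing 0ℓ 0ℓ
  ℤ/ = record
    { Carrier = ℤ
    ; _≈_     = _≡_[mod m ]
    ; _+_     = ℤ._+_
    ; _*_     = ℤ._*_
    ; -_      = ℤ.-_
    ; 0#      = + 0
    ; 1#      = + 1
    ; isCommutativeRing = record
      { isRing = record
        { +-isAbelianGroup = record
          { isGroup = record
            { isMonoid = record
              { isSemigroup = record
                { isMagma = record
                  { isEquivalence = record
                    { refl  = λ {a} → ≡⇒mod {a} refl
                    ; sym   = λ {a} {b} → sym-mod {a} {b}
                    ; trans = λ {a} {b} {c} → trans-mod {a} {b} {c}
                    }
                  ; ∙-cong = λ {a} {b} {c} {d} → +-cong-mod {a} {b} {c} {d}
                  }
                ; assoc = λ a b c → ≡⇒mod (ℤₚ.+-assoc a b c)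
                }
              ; identity = (λ a → ≡⇒mod (ℤₚ.+-identityˡ a))
                         , (λ a → ≡⇒mod (ℤₚ.+-identityʳ a))
              }
            ; inverse = (λ a → ≡⇒mod (ℤₚ.+-inverseˡ a))
                      , (λ a → ≡⇒mod (ℤₚ.+-inverseʳ a))
            ; ⁻¹-cong = λ {a} {b} → neg-cong-mod {a} {b}
            }
          ; comm = λ a b → ≡⇒mod (ℤₚ.+-comm a b)
          }
        ; *-cong     = λ {a} {b} {c} {d} → *-cong-mod {a} {b} {c} {d}
        ; *-assoc    = λ a b c → ≡⇒mod (ℤₚ.*-assoc a b c)
        ; *-identity = (λ a → ≡⇒mod (ℤₚ.*-identityˡ a))
                     , (λ a → ≡⇒mod (ℤₚ.*-identityʳ a))
        ; distrib    = (λ a b c → ≡⇒mod (ℤₚ.*-distribˡ-+ a b c))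
                     , (λ a b c → ≡⇒mod (ℤₚ.*-distribʳ-+ a b c))
        }
      ; *-comm = λ a b → ≡⇒mod (ℤₚ.*-comm a b)
      }
    }

Monomial : ℕ → Set
Monomial k = Vec ℕ k

module Polynomials {a ℓ} (R : CommutativeRing a ℓ) where
  open CommutativeRing R

  -- A polynomial in k indeterminates is a formal sum of terms; terms may
  -- repeat a monomial, so equality compares the collected coefficients.

  Poly : ℕ → Set a
  Poly k = List (Carrier × Monomial k)

  coeff : ∀ {k} → Poly k → Monomial k → Carrier
  coeff []            I = 0#
  coeff ((b , J) ∷ f) I with Vecₚ.≡-dec ℕₚ._≟_ J I
  ... | yes _ = b + coeff f I
  ... | no  _ = coeff f I

  const : ∀ {k} → Carrier → Poly k
  const b = (b , Vec.replicate _ 0) ∷ []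

  var : ∀ {k} → Fin k → Poly k
  var v = (1# , Vec.replicate _ 0 Vec.[ v ]≔ 1) ∷ []

  mulTerm : ∀ {k} → Carrier × Monomial k → Carrier × Monomial k → Carrier × Monomial k
  mulTerm (b , I) (c , J) = b * c , Vec.zipWith ℕ._+_ I J

  polySemiring : ℕ → RawSemiring a ℓ
  polySemiring k = record
    { Carrier = Poly k
    ; _≈_     = λ f g → ∀ I → coeff f I ≈ coeff g I
    ; _+_     = _++_
    ; _*_     = cartesianProductWith mulTerm
    ; 0#      = []
    ; 1#      = const 1#
    }

Matrix : ∀ {a} → Set a → ℕ → ℕ → Set a
Matrix A n t = Vector (Vector A t) n

infix 10 _ᵀ

_ᵀ : ∀ {a} {A : Set a} {n t} → Matrix A n t → Matrix A t n
_ᵀ = VecF.transpose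

module MatrixProduct {a ℓ} (R : RawSemiring a ℓ) where
  open RawSemiring R
  open RawSemiringDefs R using (sum)

  infixl 7 _⊗_

  _⊗_ : ∀ {n s t} → Matrix Carrier n s → Matrix Carrier s t → Matrix Carrier n t
  (M ⊗ N) i j = sum (λ k → M i k * N k j)

module Representation {m r : ℕ} (F : PrimeFactorization m r) where
  open PrimeFactorization F using (p; e)
  open Polynomials (ℤ/ m)

  IsAlternativeRep : ∀ {k} → Poly k → Poly k → Set
  IsAlternativeRep g f =
    ∀ I → ∃[ j ] coeff f I ≡ coeff g I [mod p j ℕ.^ e j ]

  Is1aStrongRep : ∀ {k} → Poly k → Poly k → Set
  Is1aStrongRep g f =
    IsAlternativeRep g f ×
    (∀ I i → ¬ (coeff f I ≡ coeff g I [mod p i ℕ.^ e i ]) →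
      coeff f I ≡ + 0 [mod m ])

  IsMatrix1aStrongRep : ∀ {k n} → Matrix (Poly k) n n → Matrix (Poly k) n n → Set
  IsMatrix1aStrongRep D X = ∀ i j → Is1aStrongRep (D i j) (X i j)

  X : ∀ n → Matrix (Poly (n ℕ.* n)) n n
  X n i j = var (combine i j)

  constMatrix : ∀ {k n t} → Matrix ℤ n t → Matrix (Poly k) n t
  constMatrix B i j = const (B i j)

  -- C Bᵀ X B Cᵀ, where the parenthesized factor is the t × t matrix Bᵀ X B.
  CBᵀXBCᵀ : ∀ n t → Matrix ℤ n t → Matrix ℤ n t → Matrix (Poly (n ℕ.* n)) n n
  CBᵀXBCᵀ n t B₀ C₀ = C ⊗ (B ᵀ ⊗ X n ⊗ B) ⊗ C ᵀ
    where
    open MatrixProduct (polySemiring (n ℕ.* n))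
    B = constMatrix B₀
    C = constMatrix C₀

-- A real number x is represented by its lower Dedekind cut { q ∈ ℚ | q < x },
-- so the order on reals is inclusion of cuts.

Real : Set₁
Real = Pred ℚ 0ℓ

ι : ℚ → Real
ι a = λ q → q ℚ.< a

ιℕ : ℕ → Real
ιℕ n = ι (+ n ℚ./ 1)

infix 4 _≤ᴿ_

_≤ᴿ_ : Real → Real → Set
x ≤ᴿ y = x ⊆ y

open RawSemiringDefs ℚ.+-*-rawSemiring using () renaming (_^_ to _^ℚ_)

-- Only meant for nonnegative reals: the product of signed reals differs.
infixl 7 _·_

_·_ : Real → Real → Real
x · y = λ q → q ℚ.< 0ℚ ⊎
  ∃[ a ] ∃[ b ] 0ℚ ℚ.≤ a × a ∈ x × 0ℚ ℚ.≤ b × b ∈ y × q ℚ.≤ a ℚ.* b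

infixr 8 _^ᴿ_

_^ᴿ_ : Real → ℕ → Real
x ^ᴿ zero  = ι 1ℚ
x ^ᴿ suc k = x · x ^ᴿ k

-- The r-th root of a nonnegative real, for r ≥ 1.
root : ℕ → Real → Real
root r x = λ q → q ℚ.< 0ℚ ⊎ (q ^ℚ r) ∈ x

-- exp x is the supremum of (1 + s/k)ᵏ over rationals s < x and k ≥ 1 with
-- 1 + s/k ≥ 0: (1 + s/k)ᵏ increases to exp s in this range.
exp : Real → Real
exp x = λ q → ∃[ s ] ∃[ k ] s ∈ x × 0ℚ ℚ.≤ base s k × q ℚ.< base s k ^ℚ suc k
  where
  base : ℚ → ℕ → ℚ
  base s k = 1ℚ ℚ.+ s ℚ.* (+ 1 ℚ./ suc k)

-- The natural logarithm of a positive real: q < log x iff exp q < x iff some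
-- rational u has exp q ≤ u < x.
log : Real → Real
log x = λ q → ∃[ u ] u ∈ x × exp (ι q) ≤ᴿ ι u

-- The number exp (c · ʳ√(log n · (log log n)ʳ⁻¹)), for n ≥ 3 so that
-- log log n > 0.
bound : ℚ → ℕ → ℕ → Real
bound c r n =
  exp (ι c · root r (log (ιℕ n) · log (log (ιℕ n)) ^ᴿ (r ℕ.∸ 1)))

-- t(n) = n^o(1): for every ε > 0, t(n) ≤ n^ε = exp (ε log n) eventually.
IsSubpolynomial : (ℕ → ℕ) → Set
IsSubpolynomial t =
  ∀ ε → 0ℚ ℚ.< ε →
    ∃[ N ] (∀ n → N ℕ.≤ n → ιℕ (t n) ≤ᴿ exp (ι ε · log (ιℕ n)))

{-# OPTIONS --safe #-}

-- The coefficient of x_ab in entry (i, j) of C Bᵀ X B Cᵀ is E_ia E_jb for E = C Bᵀ, so it suffices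
-- to find an integer matrix E of small rank with E_ii = 1 whose off-diagonal entries are each
-- divisible by some pⱼ^eⱼ.  Write the indices as words of length h over an alphabet of size h,
-- where hʰ ≥ n, and let d be the Hamming distance.  With Kⱼ = pⱼ^aⱼ - 1 the number C(d - 1, Kⱼ) is
-- ±1 at d = 0 and a multiple of pⱼ unless pⱼ^aⱼ divides d; if every pⱼ^aⱼ exceeds ʳ√h, then their
-- product exceeds h ≥ d, so E = ∏ⱼ C(d - 1, Kⱼ)^(2 eⱼ) works.  C(d - 1, K) is a polynomial of degree
-- K in the h indicators "the letters at this position differ", each of rank at most h + 1, so E has
-- rank at most (1 + h (h + 1))^O(ʳ√h), where h is about log n / log log n.
module Submission where

open import Defs
open import Data.Integer.Base using (ℤ)
open import Data.Nat.Base using (ℕ; _≤_; _<_)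
open import Data.Product.Base using (_×_; Σ-syntax)
open import Data.Rational.Base as ℚ using (ℚ; 0ℚ)
open import Relation.Nullary using (¬_)

open import Algebra.Bundles using (CommutativeRing)
open import Algebra.Bundles.Raw using (RawSemiring)
import Algebra.Definitions.RawSemiring as RawSemiringDefs
import Data.Integer.Properties as ℤₚ
open import Algebra.Properties.Semiring.Sum ℤₚ.+-*-semiring
  using (sum; sum-cong-≗; *-distribˡ-sum; *-distribʳ-sum)
import Data.Rational.Properties as ℚₚ
open import Algebra.Properties.CommutativeSemiring.Exp
  (CommutativeRing.commutativeSemiring ℚₚ.+-*-commutativeRing)
  using (_^_; ^-assocʳ; ^-distrib-*)
open import Data.Bool.Base using (if_then_else_)
open import Data.Fin.Base using (Fin; zero; suc; combine; remQuot; inject≤; finToFun; funToFin)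
import Data.Fin.Properties as Finₚ
open import Data.Integer.Base as ℤ using (+_)
import Data.Integer.Divisibility.Signed as ℤ∣
open import Data.Integer.Tactic.RingSolver using (solve-∀)
open import Data.List.Base
  using (List; []; _∷_; _++_; map; length; cartesianProductWith; tabulate; lookup)
open import Data.List.Properties using (length-++; length-map; length-tabulate)
open import Data.Nat.Base as ℕ using (zero; suc; z≤n; s≤s)
open import Data.Nat.Combinatorics using (nCk+nC[k+1]≡[n+1]C[k+1])
  renaming (_C_ to infixl 6.5 _choose_)
open import Data.Nat.Coprimality using (Coprime; coprime-divisor) renaming (sym to coprime-sym)
open import Data.Nat.Divisibility
  using (_∣_; _∣?_; ∣-trans; ∣⇒≤; *-monoʳ-∣; divides; ∣1⇒≡1; 1∣_)
open import Data.Nat.Primality using (Prime; prime⇒irreducible; prime⇒nonTrivial)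
import Data.Nat.Properties as ℕₚ
open import Data.Nat.Tactic.RingSolver using () renaming (solve-∀ to solve-∀ℕ)
open import Data.Product.Base using (_,_; proj₁; proj₂; ∃-syntax; uncurry)
open import Data.Rational.Base using (1ℚ; ½; fromℚᵘ; toℚᵘ)
open import Data.Rational.Unnormalised.Base as ℚᵘ using (mkℚᵘ; *≡*; *≤*)
import Data.Rational.Unnormalised.Properties as ℚᵘₚ
open import Data.Sum.Base using (inj₁; inj₂)
import Data.Vec.Base as Vec
open import Data.Vec.Functional using (foldr)
import Data.Vec.Properties as Vecₚ
open import Function.Base using (_∘_)
open import Level using (0ℓ)
open import Relation.Binary.PropositionalEquality
open import Relation.Nullary using (Dec; yes; no; ⌊_⌋; contradiction)
open import Relation.Nullary.Decidable using (toWitness; dec⇒maybe)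
open import Relation.Unary using (Decidable)
open import Tactic.RingSolver using () renaming (solve-∀ to solve-∀-over)
open import Tactic.RingSolver.Core.AlmostCommutativeRing
  using (AlmostCommutativeRing; fromCommutativeRing)

-- Matrices of small rank

-- The large alphabet saves the last factor. The logarithm of the rank is of order ʳ√h · log h.
-- Binary words would need length about log n and give ʳ√(log n) · log log n, too large by the
-- factor ʳ√(log log n). Over `h` letters, h log h of order log n suffices, and a letter costs only
-- rank `h + 1`, which changes the constant in front of log h.
--
-- `h` is a power of two, so log h is an integer up to a constant and the rank bound takes the form
-- `2 ^ L`. As 2ᴸ ≤ exp L, it remains to place `L` below the exponent of the bound. Reals are lower
-- cuts, so this takes rational lower bounds for log n and log log n, and these come from upper
-- bounds on exp at rational points. The delicate case is small `n`: log log 3 is barely positive,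
-- and the crude estimate exp (L/2) ≤ 2ᴸ does not even show log 3 > 1, so a sharper one is used
-- there.

sum-zero : ∀ {n} (f : Fin n → ℤ) → (∀ i → f i ≡ + 0) → sum f ≡ + 0
sum-zero {zero}  f h = refl
sum-zero {suc n} f h = cong₂ ℤ._+_ (h zero) (sum-zero (f ∘ suc) (h ∘ suc))

sum-single : ∀ {n} (f : Fin n → ℤ) i₀ → (∀ i → i ≢ i₀ → f i ≡ + 0) → sum f ≡ f i₀
sum-single f zero     h =
  trans (cong (ℤ._+_ (f zero)) (sum-zero (f ∘ suc) λ i → h (suc i) λ ())) (ℤₚ.+-identityʳ _)
sum-single f (suc i₀) h =
  trans (cong₂ ℤ._+_ (h zero λ ()) (sum-single (f ∘ suc) i₀ λ i ne → h (suc i) (ne ∘ Finₚ.suc-injective)))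
        (ℤₚ.+-identityˡ _)

-- A list of ℓ pairs (u , v) stands for the matrix Σ u vᵀ, of rank at most ℓ.
Kernel : Set → Set
Kernel I = List ((I → ℤ) × (I → ℤ))

infixl 7 _⊠_
infixr 8 _^ᴷ_

one : ∀ {I} → Kernel I
one = ((λ _ → + 1) , (λ _ → + 1)) ∷ []

_⊠_ : ∀ {I} → Kernel I → Kernel I → Kernel I
_⊠_ = cartesianProductWith λ (u , v) (u′ , v′) → (λ x → u x ℤ.* u′ x) , (λ y → v y ℤ.* v′ y)

_^ᴷ_ : ∀ {I} → Kernel I → ℕ → Kernel I
K ^ᴷ zero  = one
K ^ᴷ suc e = K ⊠ K ^ᴷ e

∏ᴷ : ∀ {I r} → (Fin r → Kernel I) → Kernel I
∏ᴷ {r = zero}  K = one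
∏ᴷ {r = suc r} K = K zero ⊠ ∏ᴷ (K ∘ suc)

module _ {I : Set} where

  ⟦_⟧ : Kernel I → I → I → ℤ
  ⟦ []          ⟧ x y = + 0
  ⟦ (u , v) ∷ K ⟧ x y = u x ℤ.* v y ℤ.+ ⟦ K ⟧ x y

  ⟦⟧-++ : ∀ K L x y → ⟦ K ++ L ⟧ x y ≡ ⟦ K ⟧ x y ℤ.+ ⟦ L ⟧ x y
  ⟦⟧-++ []            L x y = sym (ℤₚ.+-identityˡ _)
  ⟦⟧-++ ((u , v) ∷ K) L x y =
    trans (cong (ℤ._+_ (u x ℤ.* v y)) (⟦⟧-++ K L x y)) (sym (ℤₚ.+-assoc (u x ℤ.* v y) _ _))

  ⟦⟧-⊠ : ∀ K L x y → ⟦ K ⊠ L ⟧ x y ≡ ⟦ K ⟧ x y ℤ.* ⟦ L ⟧ x y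
  ⟦⟧-⊠ []            L x y = refl
  ⟦⟧-⊠ ((u , v) ∷ K) L x y = begin
    ⟦ map _ L ++ K ⊠ L ⟧ x y                                ≡⟨ ⟦⟧-++ (map _ L) (K ⊠ L) x y ⟩
    ⟦ map _ L ⟧ x y ℤ.+ ⟦ K ⊠ L ⟧ x y                       ≡⟨ cong₂ ℤ._+_ (scaled L) (⟦⟧-⊠ K L x y) ⟩
    u x ℤ.* v y ℤ.* ⟦ L ⟧ x y ℤ.+ ⟦ K ⟧ x y ℤ.* ⟦ L ⟧ x y   ≡⟨ ℤₚ.*-distribʳ-+ (⟦ L ⟧ x y) (u x ℤ.* v y) _ ⟨
    (u x ℤ.* v y ℤ.+ ⟦ K ⟧ x y) ℤ.* ⟦ L ⟧ x y               ∎
    where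
    open ≡-Reasoning
    eq : ∀ a b c d w → a ℤ.* c ℤ.* (b ℤ.* d) ℤ.+ a ℤ.* b ℤ.* w ≡ a ℤ.* b ℤ.* (c ℤ.* d ℤ.+ w)
    eq = solve-∀
    scaled : ∀ L → ⟦ map (λ (u′ , v′) → (λ x → u x ℤ.* u′ x) , (λ y → v y ℤ.* v′ y)) L ⟧ x y
                 ≡ u x ℤ.* v y ℤ.* ⟦ L ⟧ x y
    scaled []              = sym (ℤₚ.*-zeroʳ (u x ℤ.* v y))
    scaled ((u′ , v′) ∷ L) =
      trans (cong (ℤ._+_ (u x ℤ.* u′ x ℤ.* (v y ℤ.* v′ y))) (scaled L)) (eq (u x) (v y) (u′ x) (v′ y) _)

  ⟦⟧-^ : ∀ K e x y → ⟦ K ^ᴷ e ⟧ x y ≡ ⟦ K ⟧ x y ℤ.^ e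
  ⟦⟧-^ K zero    x y = refl
  ⟦⟧-^ K (suc e) x y =
    trans (⟦⟧-⊠ K (K ^ᴷ e) x y) (cong (⟦ K ⟧ x y ℤ.*_) (⟦⟧-^ K e x y))

  length-⊠ : ∀ (K L : Kernel I) → length (K ⊠ L) ≡ length K ℕ.* length L
  length-⊠ []      L = refl
  length-⊠ (k ∷ K) L =
    trans (length-++ (map _ L)) (cong₂ ℕ._+_ (length-map _ L) (length-⊠ K L))

  length-⊠-≤ : ∀ {K L : Kernel I} {A} d d′ → length K ℕ.≤ A ℕ.^ d → length L ℕ.≤ A ℕ.^ d′ →
               length (K ⊠ L) ℕ.≤ A ℕ.^ (d ℕ.+ d′)
  length-⊠-≤ {K} {L} {A} d d′ p q = begin
    length (K ⊠ L)        ≡⟨ length-⊠ K L ⟩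
    length K ℕ.* length L ≤⟨ ℕₚ.*-mono-≤ p q ⟩
    A ℕ.^ d ℕ.* A ℕ.^ d′  ≡⟨ ℕₚ.^-distribˡ-+-* A d d′ ⟨
    A ℕ.^ (d ℕ.+ d′)      ∎
    where open ℕₚ.≤-Reasoning

  length-^ : ∀ {K : Kernel I} {A} d e → length K ℕ.≤ A ℕ.^ d → length (K ^ᴷ e) ℕ.≤ A ℕ.^ (e ℕ.* d)
  length-^         d zero    p = ℕₚ.≤-refl
  length-^ {K} {A} d (suc e) p = length-⊠-≤ {K} {K ^ᴷ e} d (e ℕ.* d) p (length-^ {K} d e p)

  indicator : ∀ {P : Set} → Dec P → ℤ
  indicator P? = if ⌊ P? ⌋ then + 1 else + 0

  -- A kernel carries no scalar coefficients, so the minus sign of the formula below is put into the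
  -- left vector.
  match : ∀ {q} → (I → Fin q) → Fin q → (I → ℤ) × (I → ℤ)
  match c σ = (λ x → ℤ.- indicator (c x Finₚ.≟ σ)) , (λ y → indicator (c y Finₚ.≟ σ))

  -- [a ≠ b] = 1 - Σ_σ [a = σ][b = σ]
  differs : ∀ {q} → (I → Fin q) → Kernel I
  differs c = ((λ _ → + 1) , (λ _ → + 1)) ∷ tabulate (match c)

  length-differs : ∀ {q} (c : I → Fin q) → length (differs c) ≡ suc q
  length-differs c = cong suc (length-tabulate _)

  ⟦⟧-tabulate : ∀ {q} (f : Fin q → (I → ℤ) × (I → ℤ)) x y →
                ⟦ tabulate f ⟧ x y ≡ sum (λ σ → proj₁ (f σ) x ℤ.* proj₂ (f σ) y)
  ⟦⟧-tabulate {zero}  f x y = refl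
  ⟦⟧-tabulate {suc q} f x y =
    cong (ℤ._+_ (proj₁ (f zero) x ℤ.* proj₂ (f zero) y)) (⟦⟧-tabulate (f ∘ suc) x y)

  ⟦⟧-lookup : ∀ K x y → ⟦ K ⟧ x y ≡ sum (λ l → proj₁ (lookup K l) x ℤ.* proj₂ (lookup K l) y)
  ⟦⟧-lookup []            x y = refl
  ⟦⟧-lookup ((u , v) ∷ K) x y = cong (ℤ._+_ (u x ℤ.* v y)) (⟦⟧-lookup K x y)

  differs-≡ : ∀ {q} (c : I → Fin q) {x y} → c x ≡ c y → ⟦ differs c ⟧ x y ≡ + 0
  differs-≡ c {x} {y} eq = cong (ℤ._+_ (+ 1))
    (trans (⟦⟧-tabulate (match c) x y) (trans (sum-single _ (c x) other) same))
    where
    same : ℤ.- indicator (c x Finₚ.≟ c x) ℤ.* indicator (c y Finₚ.≟ c x) ≡ ℤ.- + 1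
    same with c x Finₚ.≟ c x | c y Finₚ.≟ c x
    ... | yes _ | yes _ = refl
    ... | no ne | _     = contradiction refl ne
    ... | _     | no ne = contradiction (sym eq) ne
    other : ∀ σ → σ ≢ c x → ℤ.- indicator (c x Finₚ.≟ σ) ℤ.* indicator (c y Finₚ.≟ σ) ≡ + 0
    other σ ne with c x Finₚ.≟ σ
    ... | yes refl = contradiction refl ne
    ... | no  _    = refl

  differs-≢ : ∀ {q} (c : I → Fin q) {x y} → c x ≢ c y → ⟦ differs c ⟧ x y ≡ + 1
  differs-≢ c {x} {y} ne = cong (ℤ._+_ (+ 1)) (trans (⟦⟧-tabulate (match c) x y) (sum-zero _ zero′))
    where
    zero′ : ∀ σ → ℤ.- indicator (c x Finₚ.≟ σ) ℤ.* indicator (c y Finₚ.≟ σ) ≡ + 0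
    zero′ σ with c x Finₚ.≟ σ | c y Finₚ.≟ σ
    ... | yes refl | yes eq = contradiction (sym eq) ne
    ... | yes _    | no _   = refl
    ... | no  _    | _      = refl

-- Binomial coefficients of the Hamming distance as kernels

hamming : ∀ {s q} → (Fin s → Fin q) → (Fin s → Fin q) → ℕ
hamming {zero}  u v = 0
hamming {suc s} u v with u zero Finₚ.≟ v zero
... | yes _ = hamming (u ∘ suc) (v ∘ suc)
... | no  _ = suc (hamming (u ∘ suc) (v ∘ suc))

hamming-refl : ∀ {s q} (u : Fin s → Fin q) → hamming u u ≡ 0
hamming-refl {zero}  u = refl
hamming-refl {suc s} u with u zero Finₚ.≟ u zero
... | yes _ = hamming-refl (u ∘ suc)
... | no ne = contradiction refl ne

hamming-≤ : ∀ {s q} (u v : Fin s → Fin q) → hamming u v ℕ.≤ s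
hamming-≤ {zero}  u v = z≤n
hamming-≤ {suc s} u v with u zero Finₚ.≟ v zero
... | yes _ = ℕₚ.m≤n⇒m≤1+n (hamming-≤ (u ∘ suc) (v ∘ suc))
... | no  _ = s≤s (hamming-≤ (u ∘ suc) (v ∘ suc))

hamming≡0⇒≗ : ∀ {s q} (u v : Fin s → Fin q) → hamming u v ≡ 0 → u ≗ v
hamming≡0⇒≗ {suc s} u v h i with u zero Finₚ.≟ v zero
hamming≡0⇒≗ {suc s} u v h zero    | yes eq = eq
hamming≡0⇒≗ {suc s} u v h (suc i) | yes _  = hamming≡0⇒≗ (u ∘ suc) (v ∘ suc) h i

-- C(d - 1, k), with C(-1, k) = (-1)ᵏ.
predC : ℕ → ℕ → ℤ
predC zero    k = (ℤ.- + 1) ℤ.^ k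
predC (suc d) k = + (d choose k)

-- Pascal's rule one row lower. The convention for C(-1, k) keeps it valid at `d = 0`, where
-- consecutive signs cancel against C(0, k + 1) = 0.
predC-suc : ∀ d k → predC d k ℤ.+ predC d (suc k) ≡ predC (suc d) (suc k)
predC-suc zero    k = eq ((ℤ.- + 1) ℤ.^ k)
  where
  eq : ∀ a → a ℤ.+ (ℤ.- + 1) ℤ.* a ≡ + 0
  eq = solve-∀
predC-suc (suc d) k = cong +_ (nCk+nC[k+1]≡[n+1]C[k+1] d k)

predC-0 : ∀ d → predC d 0 ≡ + 1
predC-0 zero    = refl
predC-0 (suc d) = refl

module _ {I : Set} where

  -- Σ_{l ≤ k} (-1)^(k-l) e_l at the "differs" kernels of the positions, where e_l is the
  -- elementary symmetric polynomial; on 0/1 values with d ones, e_l is C(d, l).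
  alternating : ∀ s {q} → (I → Fin s → Fin q) → ℕ → Kernel I
  alternating s       c zero    = one
  alternating zero    c (suc k) = ((λ _ → (ℤ.- + 1) ℤ.^ suc k) , (λ _ → + 1)) ∷ []
  alternating (suc s) c (suc k) =
    differs (λ x → c x zero) ⊠ alternating s (λ x → c x ∘ suc) k ++ alternating s (λ x → c x ∘ suc) (suc k)

  -- If the first letters agree, `differs` kills the first summand and the distance is that of the
  -- tails. If they differ, the distance grows by one and the recursion of `alternating` becomes
  -- `predC-suc`.
  ⟦alternating⟧ : ∀ s {q} (c : I → Fin s → Fin q) k x y →
                  ⟦ alternating s c k ⟧ x y ≡ predC (hamming (c x) (c y)) k
  ⟦alternating⟧ s       c zero    x y = sym (predC-0 (hamming (c x) (c y)))
  ⟦alternating⟧ zero    c (suc k) x y = eq ((ℤ.- + 1) ℤ.^ suc k)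
    where
    eq : ∀ a → a ℤ.* + 1 ℤ.+ + 0 ≡ a
    eq = solve-∀
  ⟦alternating⟧ (suc s) c (suc k) x y = begin
    ⟦ D ⊠ K ++ L ⟧ x y                        ≡⟨ ⟦⟧-++ (D ⊠ K) L x y ⟩
    ⟦ D ⊠ K ⟧ x y ℤ.+ ⟦ L ⟧ x y               ≡⟨ cong₂ ℤ._+_ (⟦⟧-⊠ D K x y) (⟦alternating⟧ s c′ (suc k) x y) ⟩
    ⟦ D ⟧ x y ℤ.* ⟦ K ⟧ x y ℤ.+ predC d′ (suc k)
      ≡⟨ cong (λ z → ⟦ D ⟧ x y ℤ.* z ℤ.+ predC d′ (suc k)) (⟦alternating⟧ s c′ k x y) ⟩
    ⟦ D ⟧ x y ℤ.* predC d′ k ℤ.+ predC d′ (suc k)  ≡⟨ step ⟩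
    predC (hamming (c x) (c y)) (suc k)       ∎
    where
    open ≡-Reasoning
    c′ : I → Fin s → Fin _
    c′ x = c x ∘ suc
    D K L : Kernel I
    D = differs (λ x → c x zero)
    K = alternating s c′ k
    L = alternating s c′ (suc k)
    d′ : ℕ
    d′ = hamming (c′ x) (c′ y)
    step : ⟦ D ⟧ x y ℤ.* predC d′ k ℤ.+ predC d′ (suc k) ≡ predC (hamming (c x) (c y)) (suc k)
    step with c x zero Finₚ.≟ c y zero
    ... | yes eq rewrite differs-≡ (λ x → c x zero) {x} {y} eq = ℤₚ.+-identityˡ _
    ... | no  ne rewrite differs-≢ (λ x → c x zero) {x} {y} ne =
      trans (cong (ℤ._+ predC d′ (suc k)) (ℤₚ.*-identityˡ (predC d′ k))) (predC-suc d′ k)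

  -- The base is the number of pairs in a constant plus `s` lists `differs`, that is, the cost of
  -- one linear factor. One more position adds `q + 1` to it, and this absorbs the new summand of
  -- the recursion.
  length-alternating : ∀ s {q} (c : I → Fin s → Fin q) k →
                       length (alternating s c k) ℕ.≤ suc (s ℕ.* suc q) ℕ.^ k
  length-alternating s       {q} c zero    = ℕₚ.≤-refl
  length-alternating zero    {q} c (suc k) = ℕₚ.m^n>0 1 (suc k)
  length-alternating (suc s) {q} c (suc k) = begin
    length (D ⊠ K ++ L)                       ≡⟨ length-++ (D ⊠ K) ⟩
    length (D ⊠ K) ℕ.+ length L               ≡⟨ cong (ℕ._+ length L) (length-⊠ D K) ⟩
    length D ℕ.* length K ℕ.+ length L
      ≡⟨ cong (λ z → z ℕ.* length K ℕ.+ length L) (length-differs (λ x → c x zero)) ⟩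
    suc q ℕ.* length K ℕ.+ length L
      ≤⟨ ℕₚ.+-mono-≤ (ℕₚ.*-monoʳ-≤ (suc q) (length-alternating s c′ k)) (length-alternating s c′ (suc k)) ⟩
    suc q ℕ.* A ℕ.^ k ℕ.+ A ℕ.* A ℕ.^ k       ≡⟨ ℕₚ.*-distribʳ-+ (A ℕ.^ k) (suc q) A ⟨
    (suc q ℕ.+ A) ℕ.* A ℕ.^ k                 ≤⟨ ℕₚ.*-mono-≤ (ℕₚ.≤-reflexive A′≡) (ℕₚ.^-monoˡ-≤ k A≤A′) ⟩
    A′ ℕ.^ suc k                              ∎
    where
    open ℕₚ.≤-Reasoning
    c′ : I → Fin s → Fin q
    c′ x = c x ∘ suc
    D K L : Kernel I
    D = differs (λ x → c x zero)
    K = alternating s c′ k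
    L = alternating s c′ (suc k)
    A A′ : ℕ
    A  = suc (s ℕ.* suc q)
    A′ = suc (suc s ℕ.* suc q)
    A′≡ : suc q ℕ.+ A ≡ A′
    A′≡ = ℕₚ.+-suc (suc q) (s ℕ.* suc q)
    A≤A′ : A ℕ.≤ A′
    A≤A′ = s≤s (ℕₚ.m≤n+m (s ℕ.* suc q) (suc q))

-- Binomial coefficients modulo primes

-- The absorption identity, by induction through Pascal's rule.
[k+1]*[n+1]C[k+1]≡[n+1]*nCk : ∀ n k → suc k ℕ.* (suc n choose suc k) ≡ suc n ℕ.* (n choose k)
[k+1]*[n+1]C[k+1]≡[n+1]*nCk zero    zero    = refl
[k+1]*[n+1]C[k+1]≡[n+1]*nCk zero    (suc k) = ℕₚ.*-zeroʳ (suc (suc k))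
[k+1]*[n+1]C[k+1]≡[n+1]*nCk (suc n) zero    = begin
  1 ℕ.* (suc (suc n) choose 1)        ≡⟨ cong (1 ℕ.*_) (nCk+nC[k+1]≡[n+1]C[k+1] (suc n) 0) ⟨
  1 ℕ.* (1 ℕ.+ suc n choose 1)        ≡⟨ ℕₚ.*-distribˡ-+ 1 1 (suc n choose 1) ⟩
  1 ℕ.+ 1 ℕ.* (suc n choose 1)        ≡⟨ cong (1 ℕ.+_) ([k+1]*[n+1]C[k+1]≡[n+1]*nCk n 0) ⟩
  1 ℕ.+ suc n ℕ.* 1              ∎
  where open ≡-Reasoning
[k+1]*[n+1]C[k+1]≡[n+1]*nCk (suc n) (suc k) = begin
  suc (suc k) ℕ.* (suc (suc n) choose suc (suc k))
    ≡⟨ cong (suc (suc k) ℕ.*_) (nCk+nC[k+1]≡[n+1]C[k+1] (suc n) (suc k)) ⟨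
  suc (suc k) ℕ.* (b ℕ.+ suc n choose suc (suc k))
    ≡⟨ ℕₚ.*-distribˡ-+ (suc (suc k)) b _ ⟩
  suc (suc k) ℕ.* b ℕ.+ suc (suc k) ℕ.* (suc n choose suc (suc k))
    ≡⟨ cong₂ (λ y z → b ℕ.+ y ℕ.+ z) ([k+1]*[n+1]C[k+1]≡[n+1]*nCk n k) ([k+1]*[n+1]C[k+1]≡[n+1]*nCk n (suc k)) ⟩
  b ℕ.+ suc n ℕ.* (n choose k) ℕ.+ suc n ℕ.* (n choose suc k)
    ≡⟨ ℕₚ.+-assoc b _ _ ⟩
  b ℕ.+ (suc n ℕ.* (n choose k) ℕ.+ suc n ℕ.* (n choose suc k))
    ≡⟨ cong (b ℕ.+_) (ℕₚ.*-distribˡ-+ (suc n) (n choose k) (n choose suc k)) ⟨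
  b ℕ.+ suc n ℕ.* (n choose k ℕ.+ n choose suc k)
    ≡⟨ cong (λ z → b ℕ.+ suc n ℕ.* z) (nCk+nC[k+1]≡[n+1]C[k+1] n k) ⟩
  suc (suc n) ℕ.* b ∎
  where
  open ≡-Reasoning
  b : ℕ
  b = suc n choose suc k

prime∤⇒coprime : ∀ {p n} → Prime p → ¬ p ∣ n → Coprime p n
prime∤⇒coprime pr p∤n (d∣p , d∣n) with prime⇒irreducible pr d∣p
... | inj₁ d≡1  = d≡1
... | inj₂ refl = contradiction d∣n p∤n

coprime-1 : ∀ n → Coprime 1 n
coprime-1 n (d∣1 , _) = ∣1⇒≡1 d∣1

coprime-*ˡ : ∀ {a b c} → Coprime a c → Coprime b c → Coprime (a ℕ.* b) c
coprime-*ˡ {a} {b} ac bc (d∣ab , d∣c) = bc (coprime-divisor d⊥a d∣ab , d∣c)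
  where
  d⊥a : Coprime _ a
  d⊥a (x∣d , x∣a) = ac (x∣a , ∣-trans x∣d d∣c)

coprime-^ˡ : ∀ {a c} k → Coprime a c → Coprime (a ℕ.^ k) c
coprime-^ˡ zero    ac = coprime-1 _
coprime-^ˡ (suc k) ac = coprime-*ˡ ac (coprime-^ˡ k ac)

coprime-*-∣ : ∀ {a b d} → Coprime a b → a ∣ d → b ∣ d → a ℕ.* b ∣ d
coprime-*-∣ {a} {b} ab (divides x refl) b∣d =
  subst (a ℕ.* b ∣_) (ℕₚ.*-comm a x)
    (*-monoʳ-∣ a (coprime-divisor (coprime-sym ab) (subst (b ∣_) (ℕₚ.*-comm x a) b∣d)))

distinctPrimes⇒coprime-^ : ∀ {p q} → Prime p → Prime q → p ≢ q → ∀ k l → Coprime (p ℕ.^ k) (q ℕ.^ l)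
distinctPrimes⇒coprime-^ {p} {q} pp pq p≢q k l =
  coprime-^ˡ k (coprime-sym (coprime-^ˡ l (coprime-sym (prime∤⇒coprime pp p∤q))))
  where
  p∤q : ¬ p ∣ q
  p∤q p∣q with prime⇒irreducible pq p∣q
  ... | inj₁ p≡1 = ℕₚ.<⇒≢ (ℕ.nonTrivial⇒n>1 p {{prime⇒nonTrivial pp}}) (sym p≡1)
  ... | inj₂ p≡q = p≢q p≡q

∏ : ∀ {r} → (Fin r → ℕ) → ℕ
∏ = foldr ℕ._*_ 1

coprime-∏ʳ : ∀ {r a} (f : Fin r → ℕ) → (∀ i → Coprime a (f i)) → Coprime a (∏ f)
coprime-∏ʳ {zero}  f h = coprime-sym (coprime-1 _)
coprime-∏ʳ {suc r} f h =
  coprime-sym (coprime-*ˡ (coprime-sym (h zero)) (coprime-sym (coprime-∏ʳ (f ∘ suc) (h ∘ suc))))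

∏-∣ : ∀ {r d} (f : Fin r → ℕ) → (∀ i j → i ≢ j → Coprime (f i) (f j)) → (∀ i → f i ∣ d) → ∏ f ∣ d
∏-∣ {zero}  f co h = 1∣ _
∏-∣ {suc r} f co h =
  coprime-*-∣ (coprime-∏ʳ (f ∘ suc) λ i → co zero (suc i) λ ()) (h zero)
    (∏-∣ (f ∘ suc) (λ i j ne → co (suc i) (suc j) (ne ∘ Finₚ.suc-injective)) (h ∘ suc))

^≤∏ : ∀ {r x} (f : Fin r → ℕ) → (∀ i → x ℕ.≤ f i) → x ℕ.^ r ℕ.≤ ∏ f
^≤∏ {zero}  f h = ℕₚ.≤-refl
^≤∏ {suc r} f h = ℕₚ.*-mono-≤ (h zero) (^≤∏ (f ∘ suc) (h ∘ suc))

-- With `k + 1 = pᵃ`, absorption reads (d + 1) C(d, k) = pᵃ C(d + 1, k + 1). If `p` did not divide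
-- C(d, k), then pᵃ would be coprime to it and would have to divide `d + 1`.
p∣[d-1]C[pᵃ-1] : ∀ {p a k} → Prime p → p ℕ.^ a ≡ suc k → ∀ d → ¬ p ℕ.^ a ∣ suc d → p ∣ d choose k
p∣[d-1]C[pᵃ-1] {p} {a} {k} pr eq d pᵃ∤ with p ∣? (d choose k)
... | yes p∣ = p∣
... | no  p∤ = contradiction
  (coprime-divisor (coprime-^ˡ a (prime∤⇒coprime pr p∤)) (divides (suc d choose suc k) absorbed)) pᵃ∤
  where
  absorbed : (d choose k) ℕ.* suc d ≡ (suc d choose suc k) ℕ.* p ℕ.^ a
  absorbed = begin
    (d choose k) ℕ.* suc d           ≡⟨ ℕₚ.*-comm (d choose k) (suc d) ⟩
    suc d ℕ.* (d choose k)           ≡⟨ [k+1]*[n+1]C[k+1]≡[n+1]*nCk d k ⟨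
    suc k ℕ.* (suc d choose suc k)   ≡⟨ ℕₚ.*-comm (suc k) (suc d choose suc k) ⟩
    (suc d choose suc k) ℕ.* suc k   ≡⟨ cong ((suc d choose suc k) ℕ.*_) eq ⟨
    (suc d choose suc k) ℕ.* p ℕ.^ a ∎
    where open ≡-Reasoning

-- Descends from `n` until the predecessor fails. All predicates it is applied to are upward closed,
-- so there the result is the least solution.
boundary : ∀ {P : ℕ → Set} → Decidable P → ∀ n → P n → ∃[ k ] P k × (∀ j → k ≡ suc j → ¬ P j)
boundary P? zero    pn = 0 , pn , λ _ ()
boundary P? (suc n) pn with P? n
... | yes p = boundary P? n p
... | no ¬p = suc n , pn , λ { _ refl → ¬p }

n<b^n : ∀ {b} → 2 ℕ.≤ b → ∀ n → n ℕ.< b ℕ.^ n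
n<b^n         2≤b zero    = ℕₚ.≤-refl
n<b^n {b} 2≤b (suc n) = begin
  suc (suc n)        ≤⟨ s≤s (n<b^n 2≤b n) ⟩
  1 ℕ.+ b ℕ.^ n      ≤⟨ ℕₚ.+-monoˡ-≤ (b ℕ.^ n) (ℕₚ.≤-trans (s≤s z≤n) (n<b^n 2≤b n)) ⟩
  b ℕ.^ n ℕ.+ b ℕ.^ n ≡⟨ cong (b ℕ.^ n ℕ.+_) (ℕₚ.+-identityʳ (b ℕ.^ n)) ⟨
  2 ℕ.* b ℕ.^ n      ≤⟨ ℕₚ.*-monoˡ-≤ (b ℕ.^ n) 2≤b ⟩
  b ℕ.* b ℕ.^ n      ∎
  where open ℕₚ.≤-Reasoning

floorRoot : ∀ r {h} → 1 ℕ.≤ r → 1 ℕ.≤ h → ∃[ H ] 1 ℕ.≤ H × H ℕ.^ r ℕ.≤ h × h ℕ.< suc H ℕ.^ r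
floorRoot r@(suc r′) {h} 1≤r 1≤h with boundary (λ x → h ℕₚ.<? suc x ℕ.^ r) h h<
  where
  h< : h ℕ.< suc h ℕ.^ r
  h< = begin-strict
    h                     <⟨ ℕₚ.≤-refl ⟩
    suc h                 ≡⟨ ℕₚ.*-identityʳ (suc h) ⟨
    suc h ℕ.* 1           ≤⟨ ℕₚ.*-monoʳ-≤ (suc h) (ℕₚ.m^n>0 (suc h) r′) ⟩
    suc h ℕ.* suc h ℕ.^ r′ ∎
    where open ℕₚ.≤-Reasoning
... | zero  , h<1 , _ = contradiction 1≤h (ℕₚ.<⇒≱ (subst (h ℕ.<_) (ℕₚ.^-zeroˡ r) h<1))
... | suc j , h<  , f = suc j , s≤s z≤n , ℕₚ.≮⇒≥ (f j refl) , h<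

-- The least power of `p` above `H` overshoots by at most the factor `p`, because the power before
-- it is at most `H`. So the degree `pᵃ - 1` stays linear in `H`.
powerAbove : ∀ {p H} → 2 ℕ.≤ p → 1 ℕ.≤ H → ∃[ a ] ∃[ k ] p ℕ.^ a ≡ suc k × H ℕ.≤ k × k ℕ.≤ p ℕ.* H
powerAbove {p} {H} 2≤p 1≤H with boundary (λ a → H ℕₚ.<? p ℕ.^ a) H (n<b^n 2≤p H)
... | zero  , H<1 , _ = contradiction 1≤H (ℕₚ.<⇒≱ H<1)
... | suc a , H<  , f with p ℕ.^ suc a in eq
...   | suc k = suc a , k , eq , ℕₚ.≤-pred H< ,
        ℕₚ.≤-trans (ℕₚ.n≤1+n k) (subst (ℕ._≤ p ℕ.* H) eq (ℕₚ.*-monoʳ-≤ p (ℕₚ.≮⇒≥ (f a refl))))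

module _ {m r} (F : PrimeFactorization m r) where
  open PrimeFactorization F

  2≤p : ∀ j → 2 ℕ.≤ p j
  2≤p j = ℕ.nonTrivial⇒n>1 (p j) {{prime⇒nonTrivial (prime j)}}

  -- A distance d ≤ h < (H + 1)ʳ is not a multiple of ∏ pⱼ^aⱼ > h, so some pⱼ^aⱼ does not divide it.
  coveringDegrees : ∀ {h H} → 1 ℕ.≤ H → h ℕ.< suc H ℕ.^ r →
    Σ[ K ∈ (Fin r → ℕ) ] (∀ j → K j ℕ.≤ p j ℕ.* H) ×
      (∀ d → 1 ℕ.≤ d → d ℕ.≤ h → ∃[ j ] + p j ℤ∣.∣ predC d (K j))
  coveringDegrees {h} {H} 1≤H h< = K , (λ j → proj₂ (proj₂ (proj₂ (proj₂ (above j))))) , cover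
    where
    above : ∀ j → ∃[ a ] ∃[ k ] p j ℕ.^ a ≡ suc k × H ℕ.≤ k × k ℕ.≤ p j ℕ.* H
    above j = powerAbove (2≤p j) 1≤H
    a K f : Fin r → ℕ
    a = proj₁ ∘ above
    K j = proj₁ (proj₂ (above j))
    f j = p j ℕ.^ a j
    f≡ : ∀ j → f j ≡ suc (K j)
    f≡ j = proj₁ (proj₂ (proj₂ (above j)))
    coprime : ∀ i j → i ≢ j → Coprime (f i) (f j)
    coprime i j i≢j = distinctPrimes⇒coprime-^ (prime i) (prime j) (i≢j ∘ distinct) (a i) (a j)
    h<∏ : h ℕ.< ∏ f
    h<∏ = ℕₚ.<-≤-trans h<
      (^≤∏ f λ j → subst (suc H ℕ.≤_) (sym (f≡ j)) (s≤s (proj₁ (proj₂ (proj₂ (proj₂ (above j)))))))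
    cover : ∀ d → 1 ℕ.≤ d → d ℕ.≤ h → ∃[ j ] + p j ℤ∣.∣ predC d (K j)
    cover (suc d) _ d≤h with Finₚ.¬∀⟶∃¬ r (λ j → f j ∣ suc d) (λ j → f j ∣? suc d)
        (λ all → ℕₚ.<⇒≱ h<∏ (ℕₚ.≤-trans (∣⇒≤ (∏-∣ f coprime all)) d≤h))
    ... | j , f∤d = j , ℤ∣.∣ᵤ⇒∣ (p∣[d-1]C[pᵃ-1] {a = a j} (prime j) (f≡ j) d f∤d)

-- Coefficients of C Bᵀ X B Cᵀ

module _ (m : ℕ) where
  open Polynomials (ℤ/ m)

  coeff-++ : ∀ {k} (f g : Poly k) I → coeff (f ++ g) I ≡ coeff f I ℤ.+ coeff g I
  coeff-++ []            g I = sym (ℤₚ.+-identityˡ _)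
  coeff-++ ((b , J) ∷ f) g I with Vecₚ.≡-dec ℕₚ._≟_ J I
  ... | yes _ = trans (cong (ℤ._+_ b) (coeff-++ f g I)) (sym (ℤₚ.+-assoc b _ _))
  ... | no  _ = coeff-++ f g I

  module _ {k : ℕ} where
    open RawSemiring (polySemiring k) using () renaming (_*_ to _*ᴾ_)
    open RawSemiringDefs (polySemiring k) using () renaming (sum to sumᴾ)

    coeff-sum : ∀ {n} (f : Fin n → Poly k) I → coeff (sumᴾ f) I ≡ sum (λ a → coeff (f a) I)
    coeff-sum {zero}  f I = refl
    coeff-sum {suc n} f I =
      trans (coeff-++ (f zero) _ I) (cong (ℤ._+_ (coeff (f zero) I)) (coeff-sum (f ∘ suc) I))

    0+J≡J : ∀ (J : Monomial k) → Vec.zipWith ℕ._+_ (Vec.replicate k 0) J ≡ J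
    0+J≡J = Vecₚ.zipWith-identityˡ ℕₚ.+-identityˡ

    J+0≡J : ∀ (J : Monomial k) → Vec.zipWith ℕ._+_ J (Vec.replicate k 0) ≡ J
    J+0≡J = Vecₚ.zipWith-identityʳ ℕₚ.+-identityʳ

    coeff-const-* : ∀ b (f : Poly k) I → coeff (const b *ᴾ f) I ≡ b ℤ.* coeff f I
    coeff-const-* b []            I = sym (ℤₚ.*-zeroʳ b)
    coeff-const-* b ((c , J) ∷ f) I rewrite 0+J≡J J
      with Vecₚ.≡-dec ℕₚ._≟_ J I
    ... | yes _ = trans (cong (ℤ._+_ (b ℤ.* c)) (coeff-const-* b f I)) (sym (ℤₚ.*-distribˡ-+ b c _))
    ... | no  _ = coeff-const-* b f I

    coeff-*-const : ∀ (f : Poly k) b I → coeff (f *ᴾ const b) I ≡ coeff f I ℤ.* b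
    coeff-*-const []            b I = refl
    coeff-*-const ((c , J) ∷ f) b I rewrite J+0≡J J
      with Vecₚ.≡-dec ℕₚ._≟_ J I
    ... | yes _ = trans (cong (ℤ._+_ (c ℤ.* b)) (coeff-*-const f b I)) (sym (ℤₚ.*-distribʳ-+ b c _))
    ... | no  _ = coeff-*-const f b I

    open MatrixProduct (polySemiring k)

    coeff-const-⊗ : ∀ {n s t} (M : Matrix ℤ n s) (N : Matrix (Poly k) s t) i j I →
      coeff (((λ i l → const (M i l)) ⊗ N) i j) I ≡ sum (λ l → M i l ℤ.* coeff (N l j) I)
    coeff-const-⊗ M N i j I = trans (coeff-sum (λ l → const (M i l) *ᴾ N l j) I)
      (sum-cong-≗ λ l → coeff-const-* (M i l) (N l j) I)

    coeff-⊗-const : ∀ {n s t} (M : Matrix (Poly k) n s) (N : Matrix ℤ s t) i j I →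
      coeff ((M ⊗ (λ l j → const (N l j))) i j) I ≡ sum (λ l → coeff (M i l) I ℤ.* N l j)
    coeff-⊗-const M N i j I = trans (coeff-sum (λ l → M i l *ᴾ const (N l j)) I)
      (sum-cong-≗ λ l → coeff-*-const (M i l) (N l j) I)

monomial : ∀ {k} → Fin k → Monomial k
monomial v = Vec.replicate _ 0 Vec.[ v ]≔ 1

monomial-injective : ∀ {k} {v w : Fin k} → monomial v ≡ monomial w → v ≡ w
monomial-injective {k} {v} {w} eq with v Finₚ.≟ w
... | yes v≡w = v≡w
... | no  v≢w = contradiction 1≡0 λ ()
  where
  1≡0 : 1 ≡ 0
  1≡0 = begin
    1                                     ≡⟨ Vecₚ.lookup∘updateAt v (Vec.replicate k 0) ⟨
    Vec.lookup (monomial v) v             ≡⟨ cong (λ J → Vec.lookup J v) eq ⟩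
    Vec.lookup (monomial w) v             ≡⟨ Vecₚ.lookup∘updateAt′ v w v≢w (Vec.replicate k 0) ⟩
    Vec.lookup (Vec.replicate k 0) v      ≡⟨ Vecₚ.lookup-replicate v 0 ⟩
    0                                     ∎
    where open ≡-Reasoning

module _ {n t} (B C : Matrix ℤ n t) where

  -- The sums are nested exactly as `_⊗_` unfolds in `CBᵀXBCᵀ`; `Y` will hold the coefficients of
  -- one fixed monomial in the entries of `X`.
  sandwich : Matrix ℤ n n → Matrix ℤ n n
  sandwich Y i j =
    sum λ k → sum (λ l → C i l ℤ.* sum (λ b → sum (λ a → B a l ℤ.* Y a b) ℤ.* B b k)) ℤ.* C j k

  sandwich-0 : ∀ Y → (∀ a b → Y a b ≡ + 0) → ∀ i j → sandwich Y i j ≡ + 0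
  sandwich-0 Y Y≡0 i j = sum-zero _ λ k → cong (ℤ._* C j k) (sum-zero _ λ l →
    trans (cong (ℤ._*_ (C i l)) (sum-zero _ λ b → cong (ℤ._* B b k) (sum-zero _ λ a →
      trans (cong (ℤ._*_ (B a l)) (Y≡0 a b)) (ℤₚ.*-zeroʳ (B a l)))))
      (ℤₚ.*-zeroʳ (C i l)))

  -- A matrix unit is a column times a row, so the product splits into an entry of `C Bᵀ` in row `i`
  -- times one in row `j`.
  sandwich-unit : ∀ Y a₀ b₀ → Y a₀ b₀ ≡ + 1 → (∀ a b → ¬ (a ≡ a₀ × b ≡ b₀) → Y a b ≡ + 0) →
    ∀ i j → sandwich Y i j ≡ sum (λ l → C i l ℤ.* B a₀ l) ℤ.* sum (λ k → C j k ℤ.* B b₀ k)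
  sandwich-unit Y a₀ b₀ Y≡1 Y≡0 i j = begin
    sandwich Y i j
      ≡⟨ sum-cong-≗ (λ k → cong (ℤ._* C j k) (sum-cong-≗ λ l → cong (ℤ._*_ (C i l)) (inner k l))) ⟩
    sum (λ k → sum (λ l → C i l ℤ.* (B a₀ l ℤ.* B b₀ k)) ℤ.* C j k)
      ≡⟨ sum-cong-≗ (λ k → cong (ℤ._* C j k) (trans
           (sum-cong-≗ λ l → sym (ℤₚ.*-assoc (C i l) (B a₀ l) (B b₀ k)))
           (sym (*-distribʳ-sum (B b₀ k) (λ l → C i l ℤ.* B a₀ l))))) ⟩
    sum (λ k → S ℤ.* B b₀ k ℤ.* C j k)
      ≡⟨ sum-cong-≗ (λ k → trans (ℤₚ.*-assoc S (B b₀ k) (C j k))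
           (cong (ℤ._*_ S) (ℤₚ.*-comm (B b₀ k) (C j k)))) ⟩
    sum (λ k → S ℤ.* (C j k ℤ.* B b₀ k))
      ≡⟨ *-distribˡ-sum S (λ k → C j k ℤ.* B b₀ k) ⟨
    S ℤ.* sum (λ k → C j k ℤ.* B b₀ k) ∎
    where
    open ≡-Reasoning
    S : ℤ
    S = sum (λ l → C i l ℤ.* B a₀ l)
    vanish : ∀ l a b → ¬ (a ≡ a₀ × b ≡ b₀) → B a l ℤ.* Y a b ≡ + 0
    vanish l a b ne = trans (cong (ℤ._*_ (B a l)) (Y≡0 a b ne)) (ℤₚ.*-zeroʳ (B a l))
    inner : ∀ k l → sum (λ b → sum (λ a → B a l ℤ.* Y a b) ℤ.* B b k) ≡ B a₀ l ℤ.* B b₀ k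
    inner k l = begin
      sum (λ b → sum (λ a → B a l ℤ.* Y a b) ℤ.* B b k)
        ≡⟨ sum-single _ b₀ (λ b b≢ → cong (ℤ._* B b k) (sum-zero _ λ a → vanish l a b (b≢ ∘ proj₂))) ⟩
      sum (λ a → B a l ℤ.* Y a b₀) ℤ.* B b₀ k
        ≡⟨ cong (ℤ._* B b₀ k) (sum-single _ a₀ λ a a≢ → vanish l a b₀ (a≢ ∘ proj₁)) ⟩
      B a₀ l ℤ.* Y a₀ b₀ ℤ.* B b₀ k
        ≡⟨ cong (λ y → B a₀ l ℤ.* y ℤ.* B b₀ k) Y≡1 ⟩
      B a₀ l ℤ.* + 1 ℤ.* B b₀ k
        ≡⟨ cong (ℤ._* B b₀ k) (ℤₚ.*-identityʳ (B a₀ l)) ⟩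
      B a₀ l ℤ.* B b₀ k ∎

≡⇒≡mod : ∀ {a b} m → a ≡ b → a ≡ b [mod m ]
≡⇒≡mod {a} m refl = subst (+ m ℤ∣.∣_) (sym (ℤₚ.+-inverseʳ a)) (ℤ∣.divides (+ 0) refl)

0≡mod : ∀ {b m} → + m ℤ∣.∣ b → + 0 ≡ b [mod m ]
0≡mod {b} {m} h = subst (+ m ℤ∣.∣_) (sym (ℤₚ.+-identityˡ (ℤ.- b))) (ℤ∣.∣m⇒∣-m h)

module _ {m r : ℕ} (F : PrimeFactorization m r) where
  open PrimeFactorization F using (p; e)
  open Representation F
  open Polynomials (ℤ/ m)

  -- The diagonal is asked to be 1 and not just a unit: the coefficient of x_ij in entry (i, j) is
  -- E_ii E_jj and has to agree with 1 modulo every prime power, as 1 is not 0 modulo `m`. Off the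
  -- diagonal the prime may change from entry to entry.
  IsCodiagonal : ∀ {I : Set} → (I → I → ℤ) → Set
  IsCodiagonal E = (∀ i → E i i ≡ + 1) × (∀ i k → i ≢ k → ∃[ j ] + (p j ℕ.^ e j) ℤ∣.∣ E i k)

  module _ {n t} (B C : Matrix ℤ n t) where

    coeff-CBᵀXBCᵀ : ∀ i j I →
      coeff (CBᵀXBCᵀ n t B C i j) I ≡ sandwich B C (λ a b → coeff (X n a b) I) i j
    coeff-CBᵀXBCᵀ i j I =
      trans (coeff-⊗-const m (constMatrix C ⊗ (constMatrix B ᵀ ⊗ X n ⊗ constMatrix B)) (C ᵀ) i j I)
        (sum-cong-≗ λ k → cong (ℤ._* C j k) (
      trans (coeff-const-⊗ m C (constMatrix B ᵀ ⊗ X n ⊗ constMatrix B) i k I)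
        (sum-cong-≗ λ l → cong (ℤ._*_ (C i l)) (
      trans (coeff-⊗-const m (constMatrix B ᵀ ⊗ X n) B l k I)
        (sum-cong-≗ λ b → cong (ℤ._* B b k) (
      coeff-const-⊗ m (B ᵀ) (X n) l b I))))))
      where open MatrixProduct (polySemiring (n ℕ.* n))

    coeff-X-≡ : ∀ a b → coeff (X n a b) (monomial (combine a b)) ≡ + 1
    coeff-X-≡ a b with Vecₚ.≡-dec ℕₚ._≟_ (monomial (combine a b)) (monomial (combine a b))
    ... | yes _ = refl
    ... | no ne = contradiction refl ne

    coeff-X-≢ : ∀ a b I → monomial (combine a b) ≢ I → coeff (X n a b) I ≡ + 0
    coeff-X-≢ a b I ne with Vecₚ.≡-dec ℕₚ._≟_ (monomial (combine a b)) I
    ... | yes eq = contradiction eq ne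
    ... | no  _  = refl

    -- If x_ab differs from x_ij, then `i ≢ a` or `j ≢ b`, so one factor of E_ia E_jb is off the
    -- diagonal and brings its prime power along. `j₀` is the modulus named where the two
    -- coefficients are equal as integers.
    codiagonal⇒1aStrong : Fin r → IsCodiagonal (λ i k → sum (λ l → C i l ℤ.* B k l)) →
      IsMatrix1aStrongRep (CBᵀXBCᵀ n t B C) (X n)
    codiagonal⇒1aStrong j₀ (diag , off) i j = (λ I → proj₁ (at I)) , (λ I → proj₂ (at I))
      where
      E : Matrix ℤ n n
      E i k = sum (λ l → C i l ℤ.* B k l)
      D : Poly (n ℕ.* n)
      D = CBᵀXBCᵀ n t B C i j
      At : Monomial (n ℕ.* n) → Set
      At I = (∃[ s ] coeff (X n i j) I ≡ coeff D I [mod p s ℕ.^ e s ]) ×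
        (∀ s → ¬ (coeff (X n i j) I ≡ coeff D I [mod p s ℕ.^ e s ]) → coeff (X n i j) I ≡ + 0 [mod m ])

      -- Where x_ij has coefficient 0, the second condition already has its conclusion, and one
      -- prime power dividing the coefficient of `D` gives the first.
      unequal : ∀ I → coeff (X n i j) I ≡ + 0 → ∃[ s ] + (p s ℕ.^ e s) ℤ∣.∣ coeff D I → At I
      unequal I X≡0 (s , ∣D) =
        (s , subst (_≡ coeff D I [mod p s ℕ.^ e s ]) (sym X≡0) (0≡mod ∣D)) , λ _ _ → ≡⇒≡mod m X≡0

      coeff-D : ∀ a b → coeff D (monomial (combine a b)) ≡ E i a ℤ.* E j b
      coeff-D a b = trans (coeff-CBᵀXBCᵀ i j _)
        (sandwich-unit B C _ a b (coeff-X-≡ a b) (λ a′ b′ ne → coeff-X-≢ a′ b′ _ λ eq →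
          ne (Finₚ.combine-injective a′ b′ a b (monomial-injective eq))) i j)

      at-monomial : ∀ a b → At (monomial (combine a b))
      at-monomial a b with i Finₚ.≟ a | j Finₚ.≟ b
      ... | yes refl | yes refl = (j₀ , ≡⇒≡mod _ X≡D) , λ s ne → contradiction (≡⇒≡mod _ X≡D) ne
        where
        X≡D : coeff (X n i j) (monomial (combine i j)) ≡ coeff D (monomial (combine i j))
        X≡D = trans (coeff-X-≡ i j) (sym (trans (coeff-D i j) (cong₂ ℤ._*_ (diag i) (diag j))))
      ... | no i≢a | _ with off i a i≢a
      ...   | s , ∣E = unequal _ (coeff-X-≢ i j _ λ eq →
                i≢a (proj₁ (Finₚ.combine-injective i j a b (monomial-injective eq))))
                (s , subst (_ ℤ∣.∣_) (sym (coeff-D a b)) (ℤ∣.∣m⇒∣m*n (E j b) ∣E))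
      at-monomial a b | yes _ | no j≢b with off j b j≢b
      ...   | s , ∣E = unequal _ (coeff-X-≢ i j _ λ eq →
                j≢b (proj₂ (Finₚ.combine-injective i j a b (monomial-injective eq))))
                (s , subst (_ ℤ∣.∣_) (sym (coeff-D a b)) (ℤ∣.∣n⇒∣m*n (E i a) ∣E))

      at : ∀ I → At I
      at I with Finₚ.any? (λ v → Vecₚ.≡-dec ℕₚ._≟_ (monomial v) I)
      ... | yes (v , refl) =
        subst (At ∘ monomial) (Finₚ.combine-remQuot {n} n v) (uncurry at-monomial (remQuot {n} n v))
      ... | no none = unequal I (coeff-X-≢ i j I λ eq → none (_ , eq))
        (j₀ , subst (_ ℤ∣.∣_) (sym D≡0) (ℤ∣.divides (+ 0) refl))
        where
        D≡0 : coeff D I ≡ + 0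
        D≡0 = trans (coeff-CBᵀXBCᵀ i j I)
          (sandwich-0 B C _ (λ a b → coeff-X-≢ a b I λ eq → none (_ , eq)) i j)

-- Assembly of the codiagonal kernel

^-∣-^ : ∀ {p a} k → + p ℤ∣.∣ a → + (p ℕ.^ k) ℤ∣.∣ a ℤ.^ k
^-∣-^         zero    p∣a = ℤ∣.∣-refl
^-∣-^ {p} {a} (suc k) p∣a = subst (ℤ∣._∣ a ℤ.* a ℤ.^ k) (sym (ℤₚ.pos-* p (p ℕ.^ k)))
  (ℤ∣.∣-trans (ℤ∣.*-monoˡ-∣ (+ (p ℕ.^ k)) p∣a) (ℤ∣.*-monoʳ-∣ a (^-∣-^ k p∣a)))

sign^k^2≡1 : ∀ k → ((ℤ.- + 1) ℤ.^ k) ℤ.^ 2 ≡ + 1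
sign^k^2≡1 zero    = refl
sign^k^2≡1 (suc k) = trans (eq ((ℤ.- + 1) ℤ.^ k)) (sign^k^2≡1 k)
  where
  eq : ∀ a → ((ℤ.- + 1) ℤ.* a) ℤ.* (((ℤ.- + 1) ℤ.* a) ℤ.* + 1) ≡ a ℤ.* (a ℤ.* + 1)
  eq = solve-∀

module _ {I : Set} where

  ⟦∏ᴷ⟧-≡1 : ∀ {r} (K : Fin r → Kernel I) x y → (∀ j → ⟦ K j ⟧ x y ≡ + 1) → ⟦ ∏ᴷ K ⟧ x y ≡ + 1
  ⟦∏ᴷ⟧-≡1 {zero}  K x y h = refl
  ⟦∏ᴷ⟧-≡1 {suc r} K x y h =
    trans (⟦⟧-⊠ (K zero) (∏ᴷ (K ∘ suc)) x y) (cong₂ ℤ._*_ (h zero) (⟦∏ᴷ⟧-≡1 (K ∘ suc) x y (h ∘ suc)))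

  ∣⟦∏ᴷ⟧ : ∀ {r a} (K : Fin r → Kernel I) x y j → a ℤ∣.∣ ⟦ K j ⟧ x y → a ℤ∣.∣ ⟦ ∏ᴷ K ⟧ x y
  ∣⟦∏ᴷ⟧ {a = a} K x y zero    h =
    subst (a ℤ∣.∣_) (sym (⟦⟧-⊠ (K zero) (∏ᴷ (K ∘ suc)) x y)) (ℤ∣.∣m⇒∣m*n (⟦ ∏ᴷ (K ∘ suc) ⟧ x y) h)
  ∣⟦∏ᴷ⟧ {a = a} K x y (suc j) h =
    subst (a ℤ∣.∣_) (sym (⟦⟧-⊠ (K zero) (∏ᴷ (K ∘ suc)) x y))
      (ℤ∣.∣n⇒∣m*n (⟦ K zero ⟧ x y) (∣⟦∏ᴷ⟧ (K ∘ suc) x y j h))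

  length-∏ᴷ : ∀ {r A} (K : Fin r → Kernel I) (d : Fin r → ℕ) → (∀ j → length (K j) ℕ.≤ A ℕ.^ d j) →
              length (∏ᴷ K) ℕ.≤ A ℕ.^ foldr ℕ._+_ 0 d
  length-∏ᴷ {zero}  K d h = ℕₚ.≤-refl
  length-∏ᴷ {suc r} K d h =
    length-⊠-≤ {K = K zero} (d zero) (foldr ℕ._+_ 0 (d ∘ suc)) (h zero) (length-∏ᴷ (K ∘ suc) (d ∘ suc) (h ∘ suc))

funToFin-cong : ∀ {s q} {f g : Fin s → Fin q} → f ≗ g → funToFin f ≡ funToFin g
funToFin-cong {zero}  eq = refl
funToFin-cong {suc s} eq = cong₂ combine (eq zero) (funToFin-cong (eq ∘ suc))

∑-≤ : ∀ {r H} (f g : Fin r → ℕ) → (∀ j → f j ℕ.≤ g j ℕ.* H) → foldr ℕ._+_ 0 f ℕ.≤ foldr ℕ._+_ 0 g ℕ.* H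
∑-≤ {zero}      f g h = z≤n
∑-≤ {suc r} {H} f g h = ℕₚ.≤-trans (ℕₚ.+-mono-≤ (h zero) (∑-≤ (f ∘ suc) (g ∘ suc) (h ∘ suc)))
  (ℕₚ.≤-reflexive (sym (ℕₚ.*-distribʳ-+ H (g zero) _)))

module _ {m r : ℕ} (F : PrimeFactorization m r) where
  open PrimeFactorization F using (p; e)

  -- Total degree per unit of `H`: the factor for `p j` has degree `e j * (2 * K j)`, and `K j` is
  -- at most `p j * H`. The `suc` makes `Q` positive by computation, as `1≤L` wants.
  Q : ℕ
  Q = suc (foldr ℕ._+_ 0 (λ j → e j ℕ.* (2 ℕ.* p j)))

  codiagonalKernel : ∀ {n h H} → n ℕ.≤ h ℕ.^ h → 1 ℕ.≤ H → h ℕ.< suc H ℕ.^ r →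
    Σ[ E ∈ Kernel (Fin n) ] IsCodiagonal F ⟦ E ⟧ × length E ℕ.≤ suc (h ℕ.* suc h) ℕ.^ (Q ℕ.* H)
  codiagonalKernel {n} {h} {H} n≤ 1≤H h< = ∏ᴷ factor , (diag , off) , bound′
    where
    degrees = coveringDegrees F 1≤H h<
    K : Fin r → ℕ
    K = proj₁ degrees
    code : Fin n → Fin h → Fin h
    code i = finToFun (inject≤ i n≤)
    base factor : Fin r → Kernel (Fin n)
    base j = alternating h code (K j)
    -- Squaring turns the sign on the diagonal into 1; the power `e j` raises divisibility by `p j`
    -- to divisibility by `p j ^ e j`.
    factor j = (base j ^ᴷ 2) ^ᴷ e j

    code-injective : ∀ {i k} → code i ≗ code k → i ≡ k
    code-injective {i} {k} eq = Finₚ.inject≤-injective n≤ n≤ i k (begin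
      inject≤ i n≤                       ≡⟨ Finₚ.funToFin-finToFin {h} {h} (inject≤ i n≤) ⟨
      funToFin (code i)    ≡⟨ funToFin-cong eq ⟩
      funToFin (code k)    ≡⟨ Finₚ.funToFin-finToFin {h} {h} (inject≤ k n≤) ⟩
      inject≤ k n≤                       ∎)
      where open ≡-Reasoning

    ⟦factor⟧ : ∀ j x y → ⟦ factor j ⟧ x y ≡ (predC (hamming (code x) (code y)) (K j) ℤ.^ 2) ℤ.^ e j
    ⟦factor⟧ j x y = trans (⟦⟧-^ (base j ^ᴷ 2) (e j) x y) (cong (ℤ._^ e j)
      (trans (⟦⟧-^ (base j) 2 x y) (cong (ℤ._^ 2) (⟦alternating⟧ h code (K j) x y))))

    diag : ∀ i → ⟦ ∏ᴷ factor ⟧ i i ≡ + 1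
    diag i = ⟦∏ᴷ⟧-≡1 factor i i λ j → trans (⟦factor⟧ j i i) (trans
      (cong (ℤ._^ e j) (trans (cong (λ d → predC d (K j) ℤ.^ 2) (hamming-refl (code i))) (sign^k^2≡1 (K j))))
      (ℤₚ.^-zeroˡ (e j)))

    off : ∀ i k → i ≢ k → ∃[ j ] + (p j ℕ.^ e j) ℤ∣.∣ ⟦ ∏ᴷ factor ⟧ i k
    off i k i≢k with proj₂ (proj₂ degrees) (hamming (code i) (code k))
      (ℕₚ.n≢0⇒n>0 (i≢k ∘ code-injective ∘ hamming≡0⇒≗ (code i) (code k))) (hamming-≤ (code i) (code k))
    ... | j , p∣ = j , ∣⟦∏ᴷ⟧ factor i k j (subst (_ ℤ∣.∣_) (sym (⟦factor⟧ j i k))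
      (^-∣-^ (e j) (ℤ∣.∣m⇒∣m*n _ p∣)))

    bound′ : length (∏ᴷ factor) ℕ.≤ suc (h ℕ.* suc h) ℕ.^ (Q ℕ.* H)
    bound′ = ℕₚ.≤-trans
      (length-∏ᴷ factor (λ j → e j ℕ.* (2 ℕ.* K j)) λ j → length-^ {K = base j ^ᴷ 2} (2 ℕ.* K j) (e j)
        (length-^ {K = base j} (K j) 2 (length-alternating h code (K j))))
      (ℕₚ.^-monoʳ-≤ (suc (h ℕ.* suc h)) (ℕₚ.≤-trans
        (∑-≤ _ (λ j → e j ℕ.* (2 ℕ.* p j)) λ j → degree j)
        (ℕₚ.m≤n+m _ H)))
      where
      degree : ∀ j → e j ℕ.* (2 ℕ.* K j) ℕ.≤ e j ℕ.* (2 ℕ.* p j) ℕ.* H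
      degree j = begin
        e j ℕ.* (2 ℕ.* K j)           ≤⟨ ℕₚ.*-monoʳ-≤ (e j) (ℕₚ.*-monoʳ-≤ 2 (proj₁ (proj₂ degrees) j)) ⟩
        e j ℕ.* (2 ℕ.* (p j ℕ.* H))   ≡⟨ cong (e j ℕ.*_) (ℕₚ.*-assoc 2 (p j) H) ⟨
        e j ℕ.* (2 ℕ.* p j ℕ.* H)     ≡⟨ ℕₚ.*-assoc (e j) (2 ℕ.* p j) H ⟨
        e j ℕ.* (2 ℕ.* p j) ℕ.* H     ∎
        where open ℕₚ.≤-Reasoning

-- Bounds on exp and log

ℚ-ring : AlmostCommutativeRing 0ℓ 0ℓ
ℚ-ring = fromCommutativeRing ℚₚ.+-*-commutativeRing (λ x → dec⇒maybe (0ℚ ℚₚ.≟ x))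

-- Normalised fractions with variable entries do not add or multiply by computation. `⌜_⌝` and `1/`
-- are values of `fromℚᵘ`, so identities between them reduce to integer identities between
-- unnormalised fractions.
fromℚᵘ-homo-+ : ∀ a b → fromℚᵘ (a ℚᵘ.+ b) ≡ fromℚᵘ a ℚ.+ fromℚᵘ b
fromℚᵘ-homo-+ a b = ℚₚ.toℚᵘ-injective (begin-equality
  toℚᵘ (fromℚᵘ (a ℚᵘ.+ b))                  ≃⟨ ℚₚ.toℚᵘ-fromℚᵘ (a ℚᵘ.+ b) ⟩
  a ℚᵘ.+ b                                  ≃⟨ ℚᵘₚ.+-cong (ℚₚ.toℚᵘ-fromℚᵘ a) (ℚₚ.toℚᵘ-fromℚᵘ b) ⟨
  toℚᵘ (fromℚᵘ a) ℚᵘ.+ toℚᵘ (fromℚᵘ b)      ≃⟨ ℚₚ.toℚᵘ-homo-+ (fromℚᵘ a) (fromℚᵘ b) ⟨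
  toℚᵘ (fromℚᵘ a ℚ.+ fromℚᵘ b)              ∎)
  where open ℚᵘₚ.≤-Reasoning

fromℚᵘ-homo-* : ∀ a b → fromℚᵘ (a ℚᵘ.* b) ≡ fromℚᵘ a ℚ.* fromℚᵘ b
fromℚᵘ-homo-* a b = ℚₚ.toℚᵘ-injective (begin-equality
  toℚᵘ (fromℚᵘ (a ℚᵘ.* b))                  ≃⟨ ℚₚ.toℚᵘ-fromℚᵘ (a ℚᵘ.* b) ⟩
  a ℚᵘ.* b                                  ≃⟨ ℚᵘₚ.*-cong (ℚₚ.toℚᵘ-fromℚᵘ a) (ℚₚ.toℚᵘ-fromℚᵘ b) ⟨
  toℚᵘ (fromℚᵘ a) ℚᵘ.* toℚᵘ (fromℚᵘ b)      ≃⟨ ℚₚ.toℚᵘ-homo-* (fromℚᵘ a) (fromℚᵘ b) ⟨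
  toℚᵘ (fromℚᵘ a ℚ.* fromℚᵘ b)              ∎)
  where open ℚᵘₚ.≤-Reasoning

fromℚᵘ-mono-≤ : ∀ {a b} → a ℚᵘ.≤ b → fromℚᵘ a ℚ.≤ fromℚᵘ b
fromℚᵘ-mono-≤ {a} {b} a≤b = ℚₚ.toℚᵘ-cancel-≤
  (ℚᵘₚ.≤-respˡ-≃ (ℚᵘₚ.≃-sym (ℚₚ.toℚᵘ-fromℚᵘ a)) (ℚᵘₚ.≤-respʳ-≃ (ℚᵘₚ.≃-sym (ℚₚ.toℚᵘ-fromℚᵘ b)) a≤b))

fromℚᵘ-mono-< : ∀ {a b} → a ℚᵘ.< b → fromℚᵘ a ℚ.< fromℚᵘ b
fromℚᵘ-mono-< {a} {b} a<b = ℚₚ.toℚᵘ-cancel-<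
  (ℚᵘₚ.<-respˡ-≃ (ℚᵘₚ.≃-sym (ℚₚ.toℚᵘ-fromℚᵘ a)) (ℚᵘₚ.<-respʳ-≃ (ℚᵘₚ.≃-sym (ℚₚ.toℚᵘ-fromℚᵘ b)) a<b))

⌜_⌝ : ℕ → ℚ
⌜ n ⌝ = + n ℚ./ 1

-- Off by one: 1/ 41 is 1/42.
1/ : ℕ → ℚ
1/ k = + 1 ℚ./ suc k

⌜⌝-+ : ∀ a b → ⌜ a ℕ.+ b ⌝ ≡ ⌜ a ⌝ ℚ.+ ⌜ b ⌝
⌜⌝-+ a b = trans (ℚₚ.fromℚᵘ-cong {mkℚᵘ (+ (a ℕ.+ b)) 0} {mkℚᵘ (+ a) 0 ℚᵘ.+ mkℚᵘ (+ b) 0}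
  (*≡* (eq (+ a) (+ b)))) (fromℚᵘ-homo-+ (mkℚᵘ (+ a) 0) (mkℚᵘ (+ b) 0))
  where
  eq : ∀ x y → (x ℤ.+ y) ℤ.* + 1 ≡ (x ℤ.* + 1 ℤ.+ y ℤ.* + 1) ℤ.* + 1
  eq = solve-∀

⌜⌝-* : ∀ a b → ⌜ a ℕ.* b ⌝ ≡ ⌜ a ⌝ ℚ.* ⌜ b ⌝
⌜⌝-* a b = trans (ℚₚ.fromℚᵘ-cong {mkℚᵘ (+ (a ℕ.* b)) 0} {mkℚᵘ (+ a) 0 ℚᵘ.* mkℚᵘ (+ b) 0}
  (*≡* (cong (ℤ._* + 1) (ℤₚ.pos-* a b)))) (fromℚᵘ-homo-* (mkℚᵘ (+ a) 0) (mkℚᵘ (+ b) 0))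

⌜⌝-^ : ∀ a k → ⌜ a ℕ.^ k ⌝ ≡ ⌜ a ⌝ ^ k
⌜⌝-^ a zero    = refl
⌜⌝-^ a (suc k) = trans (⌜⌝-* a (a ℕ.^ k)) (cong (⌜ a ⌝ ℚ.*_) (⌜⌝-^ a k))

⌜⌝-mono-≤ : ∀ {a b} → a ℕ.≤ b → ⌜ a ⌝ ℚ.≤ ⌜ b ⌝
⌜⌝-mono-≤ {a} {b} a≤b = fromℚᵘ-mono-≤ {mkℚᵘ (+ a) 0} {mkℚᵘ (+ b) 0} (*≤* (ℤₚ.*-monoʳ-≤-nonNeg (+ 1) (ℤ.+≤+ a≤b)))

⌜⌝-mono-< : ∀ {a b} → a ℕ.< b → ⌜ a ⌝ ℚ.< ⌜ b ⌝
⌜⌝-mono-< {a} {b} a<b = fromℚᵘ-mono-< {mkℚᵘ (+ a) 0} {mkℚᵘ (+ b) 0} (ℚᵘ.*<* (ℤₚ.*-monoʳ-<-pos (+ 1) (ℤ.+<+ a<b)))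

1/-inverse : ∀ k → ⌜ suc k ⌝ ℚ.* 1/ k ≡ 1ℚ
1/-inverse k = trans (sym (fromℚᵘ-homo-* (mkℚᵘ (+ suc k) 0) (mkℚᵘ (+ 1) k)))
  (ℚₚ.fromℚᵘ-cong {mkℚᵘ (+ suc k) 0 ℚᵘ.* mkℚᵘ (+ 1) k} {mkℚᵘ (+ 1) 0} (*≡* (cong +_ (eq k))))
  where
  eq : ∀ k → suc k ℕ.* 1 ℕ.* 1 ≡ 1 ℕ.* (1 ℕ.* suc k)
  eq = solve-∀ℕ

0≤⌜⌝ : ∀ n → 0ℚ ℚ.≤ ⌜ n ⌝
0≤⌜⌝ n = ⌜⌝-mono-≤ {0} {n} z≤n

0≤1/ : ∀ k → 0ℚ ℚ.≤ 1/ k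
0≤1/ k = ℚₚ.<⇒≤ (ℚₚ.positive⁻¹ (1/ k) {{ℚₚ.normalize-pos 1 (suc k)}})

*-mono-≤ : ∀ {p q r s} → 0ℚ ℚ.≤ q → p ℚ.≤ q → 0ℚ ℚ.≤ r → r ℚ.≤ s → p ℚ.* r ℚ.≤ q ℚ.* s
*-mono-≤ {p} {q} {r} {s} 0≤q p≤q 0≤r r≤s = ℚₚ.≤-trans
  (ℚₚ.*-monoʳ-≤-nonNeg r {{ℚ.nonNegative 0≤r}} p≤q) (ℚₚ.*-monoˡ-≤-nonNeg q {{ℚ.nonNegative 0≤q}} r≤s)

0≤* : ∀ {p q} → 0ℚ ℚ.≤ p → 0ℚ ℚ.≤ q → 0ℚ ℚ.≤ p ℚ.* q
0≤* {p} {q} 0≤p 0≤q = ℚₚ.nonNegative⁻¹ (p ℚ.* q)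
  {{ℚₚ.nonNeg*nonNeg⇒nonNeg p {{ℚ.nonNegative 0≤p}} q {{ℚ.nonNegative 0≤q}}}}

0≤^ : ∀ {p} n → 0ℚ ℚ.≤ p → 0ℚ ℚ.≤ p ^ n
0≤^ zero    0≤p = 0≤⌜⌝ 1
0≤^ (suc n) 0≤p = 0≤* 0≤p (0≤^ n 0≤p)

^-monoˡ-≤ : ∀ {p q} n → 0ℚ ℚ.≤ p → p ℚ.≤ q → p ^ n ℚ.≤ q ^ n
^-monoˡ-≤ zero    0≤p p≤q = ℚₚ.≤-refl
^-monoˡ-≤ (suc n) 0≤p p≤q = *-mono-≤ (ℚₚ.≤-trans 0≤p p≤q) p≤q (0≤^ n 0≤p) (^-monoˡ-≤ n 0≤p p≤q)

^-≤1 : ∀ {p} n → 0ℚ ℚ.≤ p → p ℚ.≤ 1ℚ → p ^ n ℚ.≤ 1ℚ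
^-≤1 zero    0≤p p≤1 = ℚₚ.≤-refl
^-≤1 (suc n) 0≤p p≤1 = *-mono-≤ (0≤⌜⌝ 1) p≤1 (0≤^ n 0≤p) (^-≤1 n 0≤p p≤1)

0≤p*p : ∀ p → 0ℚ ℚ.≤ p ℚ.* p
0≤p*p p with ℚₚ.≤-total 0ℚ p
... | inj₁ 0≤p = 0≤* 0≤p 0≤p
... | inj₂ p≤0 = ℚₚ.nonNegative⁻¹ (p ℚ.* p)
  {{ℚₚ.nonPos*nonPos⇒nonPos p {{ℚ.nonPositive p≤0}} p {{ℚ.nonPositive p≤0}}}}

p≤p+q : ∀ p {q} → 0ℚ ℚ.≤ q → p ℚ.≤ p ℚ.+ q
p≤p+q p {q} 0≤q = subst (ℚ._≤ p ℚ.+ q) (ℚₚ.+-identityʳ p) (ℚₚ.+-monoʳ-≤ p 0≤q)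

-- The hypothesis reaches down to `y = -1` because `approximant≤` needs the inequality at a negative
-- argument.
bernoulli : ∀ {y} → 0ℚ ℚ.≤ 1ℚ ℚ.+ y → ∀ n → 1ℚ ℚ.+ ⌜ n ⌝ ℚ.* y ℚ.≤ (1ℚ ℚ.+ y) ^ n
bernoulli {y} 0≤1+y zero    = ℚₚ.≤-reflexive (trans (cong (1ℚ ℚ.+_) (ℚₚ.*-zeroˡ y)) (ℚₚ.+-identityʳ 1ℚ))
bernoulli {y} 0≤1+y (suc n) = begin
  1ℚ ℚ.+ ⌜ suc n ⌝ ℚ.* y                                       ≡⟨ cong (λ z → 1ℚ ℚ.+ z ℚ.* y) (⌜⌝-+ 1 n) ⟩
  1ℚ ℚ.+ (1ℚ ℚ.+ ⌜ n ⌝) ℚ.* y                                  ≤⟨ p≤p+q _ (0≤* (0≤⌜⌝ n) (0≤p*p y)) ⟩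
  1ℚ ℚ.+ (1ℚ ℚ.+ ⌜ n ⌝) ℚ.* y ℚ.+ ⌜ n ⌝ ℚ.* (y ℚ.* y)          ≡⟨ eq y ⌜ n ⌝ ⟩
  (1ℚ ℚ.+ y) ℚ.* (1ℚ ℚ.+ ⌜ n ⌝ ℚ.* y)
    ≤⟨ ℚₚ.*-monoˡ-≤-nonNeg (1ℚ ℚ.+ y) {{ℚ.nonNegative 0≤1+y}} (bernoulli 0≤1+y n) ⟩
  (1ℚ ℚ.+ y) ℚ.* (1ℚ ℚ.+ y) ^ n                                ∎
  where
  open ℚₚ.≤-Reasoning
  eq : ∀ y n → 1ℚ ℚ.+ (1ℚ ℚ.+ n) ℚ.* y ℚ.+ n ℚ.* (y ℚ.* y) ≡ (1ℚ ℚ.+ y) ℚ.* (1ℚ ℚ.+ n ℚ.* y)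
  eq = solve-∀-over ℚ-ring

-- From (1 + y)ᵏ (1 - y)ᵏ ≤ 1 and (1 - y)ᵏ ≥ 1 - k y with y = x/k: exp x ≤ v = 1 / (1 - x).
module _ {x v : ℚ} (0≤x : 0ℚ ℚ.≤ x) (x≤1 : x ℚ.≤ 1ℚ) (0≤v : 0ℚ ℚ.≤ v) (v[1-x]≡1 : v ℚ.* (1ℚ ℚ.- x) ≡ 1ℚ) where

  private
    1/≤1 : ∀ k → 1/ k ℚ.≤ 1ℚ
    1/≤1 k = begin
      1/ k                    ≡⟨ ℚₚ.*-identityˡ (1/ k) ⟨
      1ℚ ℚ.* 1/ k             ≤⟨ *-mono-≤ (0≤⌜⌝ (suc k)) (⌜⌝-mono-≤ {1} {suc k} (s≤s z≤n)) (0≤1/ k) ℚₚ.≤-refl ⟩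
      ⌜ suc k ⌝ ℚ.* 1/ k      ≡⟨ 1/-inverse k ⟩
      1ℚ                      ∎
      where open ℚₚ.≤-Reasoning

    approximant≤ : ∀ k → (1ℚ ℚ.+ x ℚ.* 1/ k) ^ suc k ℚ.≤ v
    approximant≤ k = begin
      U ^ K                                   ≡⟨ ℚₚ.*-identityʳ _ ⟨
      U ^ K ℚ.* 1ℚ                            ≡⟨ cong (U ^ K ℚ.*_) v[1-x]≡1 ⟨
      U ^ K ℚ.* (v ℚ.* (1ℚ ℚ.- x))            ≡⟨ cong (λ z → U ^ K ℚ.* (v ℚ.* z)) 1-x≡ ⟩
      U ^ K ℚ.* (v ℚ.* (1ℚ ℚ.+ ⌜ K ⌝ ℚ.* ℚ.- y))
        ≤⟨ ℚₚ.*-monoˡ-≤-nonNeg (U ^ K) {{ℚ.nonNegative (0≤^ K 0≤U)}}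
             (ℚₚ.*-monoˡ-≤-nonNeg v {{ℚ.nonNegative 0≤v}} (bernoulli 0≤W K)) ⟩
      U ^ K ℚ.* (v ℚ.* W ^ K)                 ≡⟨ swap (U ^ K) v (W ^ K) ⟩
      v ℚ.* (U ^ K ℚ.* W ^ K)                 ≡⟨ cong (v ℚ.*_) (^-distrib-* U W K) ⟨
      v ℚ.* (U ℚ.* W) ^ K
        ≤⟨ ℚₚ.*-monoˡ-≤-nonNeg v {{ℚ.nonNegative 0≤v}} (^-≤1 K (0≤* 0≤U 0≤W) UW≤1) ⟩
      v ℚ.* 1ℚ                                ≡⟨ ℚₚ.*-identityʳ v ⟩
      v                                       ∎
      where
      open ℚₚ.≤-Reasoning
      K : ℕ
      K = suc k
      y U W : ℚ
      y = x ℚ.* 1/ k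
      U = 1ℚ ℚ.+ y
      W = 1ℚ ℚ.+ ℚ.- y
      0≤y : 0ℚ ℚ.≤ y
      0≤y = 0≤* 0≤x (0≤1/ k)
      y≤1 : y ℚ.≤ 1ℚ
      y≤1 = *-mono-≤ (0≤⌜⌝ 1) x≤1 (0≤1/ k) (1/≤1 k)
      0≤U : 0ℚ ℚ.≤ U
      0≤U = ℚₚ.+-mono-≤ (0≤⌜⌝ 1) 0≤y
      0≤W : 0ℚ ℚ.≤ W
      0≤W = subst (ℚ._≤ W) (ℚₚ.+-inverseʳ y) (ℚₚ.+-monoˡ-≤ (ℚ.- y) y≤1)
      square : ∀ y → (1ℚ ℚ.+ y) ℚ.* (1ℚ ℚ.+ ℚ.- y) ℚ.+ y ℚ.* y ≡ 1ℚ
      square = solve-∀-over ℚ-ring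
      UW≤1 : U ℚ.* W ℚ.≤ 1ℚ
      UW≤1 = subst (U ℚ.* W ℚ.≤_) (square y) (p≤p+q (U ℚ.* W) (0≤p*p y))
      swap : ∀ a b c → a ℚ.* (b ℚ.* c) ≡ b ℚ.* (a ℚ.* c)
      swap = solve-∀-over ℚ-ring
      pull : ∀ a x z → a ℚ.* ℚ.- (x ℚ.* z) ≡ ℚ.- x ℚ.* (a ℚ.* z)
      pull = solve-∀-over ℚ-ring
      1-x≡ : 1ℚ ℚ.- x ≡ 1ℚ ℚ.+ ⌜ K ⌝ ℚ.* ℚ.- y
      1-x≡ = cong (1ℚ ℚ.+_) (sym (trans (pull ⌜ K ⌝ x (1/ k))
        (trans (cong (ℚ.- x ℚ.*_) (1/-inverse k)) (ℚₚ.*-identityʳ (ℚ.- x)))))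

  -- Bernoulli once more: with K = k + 1, 1 + L x / K ≤ (1 + x / K)ᴸ. So the bound at `x ≤ 1` can be
  -- raised to the power `L` and reaches arguments of any size.
  exp-≤ : ∀ L → exp (ι (⌜ L ⌝ ℚ.* x)) ≤ᴿ ι (v ^ L)
  exp-≤ L {q} (s , k , s<Lx , 0≤base , q<) = ℚₚ.<-≤-trans q< (begin
    (1ℚ ℚ.+ s ℚ.* 1/ k) ^ suc k                   ≤⟨ ^-monoˡ-≤ (suc k) 0≤base base≤ ⟩
    (U ^ L) ^ suc k                               ≡⟨ ^-assocʳ U L (suc k) ⟩
    U ^ (L ℕ.* suc k)                             ≡⟨ cong (U ^_) (ℕₚ.*-comm L (suc k)) ⟩
    U ^ (suc k ℕ.* L)                             ≡⟨ ^-assocʳ U (suc k) L ⟨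
    (U ^ suc k) ^ L                               ≤⟨ ^-monoˡ-≤ L (0≤^ (suc k) 0≤U) (approximant≤ k) ⟩
    v ^ L                                         ∎)
    where
    open ℚₚ.≤-Reasoning
    U : ℚ
    U = 1ℚ ℚ.+ x ℚ.* 1/ k
    0≤U : 0ℚ ℚ.≤ U
    0≤U = ℚₚ.+-mono-≤ (0≤⌜⌝ 1) (0≤* 0≤x (0≤1/ k))
    base≤ : 1ℚ ℚ.+ s ℚ.* 1/ k ℚ.≤ U ^ L
    base≤ = begin
      1ℚ ℚ.+ s ℚ.* 1/ k
        ≤⟨ ℚₚ.+-monoʳ-≤ 1ℚ (ℚₚ.*-monoʳ-≤-nonNeg (1/ k) {{ℚ.nonNegative (0≤1/ k)}} (ℚₚ.<⇒≤ s<Lx)) ⟩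
      1ℚ ℚ.+ ⌜ L ⌝ ℚ.* x ℚ.* 1/ k                 ≡⟨ cong (1ℚ ℚ.+_) (ℚₚ.*-assoc ⌜ L ⌝ x (1/ k)) ⟩
      1ℚ ℚ.+ ⌜ L ⌝ ℚ.* (x ℚ.* 1/ k)               ≤⟨ bernoulli 0≤U L ⟩
      U ^ L                                       ∎

  -- Every lower bound on a logarithm below comes from here: `x` and `v` set the precision, `L` the
  -- size.
  ∈-log : ∀ {ξ : Real} {q u} L → q ℚ.≤ ⌜ L ⌝ ℚ.* x → v ^ L ℚ.≤ u → ξ u → log ξ q
  ∈-log {u = u} L q≤ vᴸ≤u u∈ξ = u , u∈ξ , λ { (s , k , s<q , rest) →
    ℚₚ.<-≤-trans (exp-≤ L (s , k , ℚₚ.<-≤-trans s<q q≤ , rest)) vᴸ≤u }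

-- At s = k = L the approximant (1 + s/k)ᵏ is 2ᴸ.
≤-exp : ∀ {ξ : Real} {t L} → 1 ℕ.≤ L → t ℕ.≤ 2 ℕ.^ L → ξ ⌜ L ⌝ → ιℕ t ≤ᴿ exp ξ
≤-exp {t = t} {L = suc k} _ t≤ L∈ξ {q} q<t =
  ⌜ suc k ⌝ , k , L∈ξ , subst (0ℚ ℚ.≤_) (sym base≡2) (0≤⌜⌝ 2) ,
  subst (λ z → q ℚ.< z ^ suc k) (sym base≡2)
    (ℚₚ.<-≤-trans q<t (ℚₚ.≤-trans (⌜⌝-mono-≤ t≤) (ℚₚ.≤-reflexive (⌜⌝-^ 2 (suc k)))))
  where
  base≡2 : 1ℚ ℚ.+ ⌜ suc k ⌝ ℚ.* 1/ k ≡ ⌜ 2 ⌝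
  base≡2 = cong (1ℚ ℚ.+_) (1/-inverse k)

-- The factor `δ` is forced by `ξ ^ᴿ 0`, the open cut of 1, which does not contain 1 itself.
∈-^ᴿ : ∀ {ξ : Real} {μ δ} → 0ℚ ℚ.≤ μ → ξ μ → 0ℚ ℚ.≤ δ → δ ℚ.< 1ℚ → ∀ k → (ξ ^ᴿ k) (μ ^ k ℚ.* δ)
∈-^ᴿ             0≤μ μ∈ξ 0≤δ δ<1 zero    = subst (ℚ._< 1ℚ) (sym (ℚₚ.*-identityˡ _)) δ<1
∈-^ᴿ {μ = μ} {δ} 0≤μ μ∈ξ 0≤δ δ<1 (suc k) = inj₂
  (μ , μ ^ k ℚ.* δ , 0≤μ , μ∈ξ , 0≤* (0≤^ k 0≤μ) 0≤δ , ∈-^ᴿ 0≤μ μ∈ξ 0≤δ δ<1 k ,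
   ℚₚ.≤-reflexive (ℚₚ.*-assoc μ (μ ^ k) δ))

/-mono-≤ : ∀ a b c d → a ℕ.* suc d ℕ.≤ b ℕ.* suc c → ⌜ a ⌝ ℚ.* 1/ c ℚ.≤ ⌜ b ⌝ ℚ.* 1/ d
/-mono-≤ a b c d h = begin
  ⌜ a ⌝ ℚ.* 1/ c                                ≡⟨ insert a c d ⟩
  ⌜ a ℕ.* suc d ⌝ ℚ.* (1/ c ℚ.* 1/ d)
    ≤⟨ *-mono-≤ (0≤⌜⌝ (b ℕ.* suc c)) (⌜⌝-mono-≤ h) (0≤* (0≤1/ c) (0≤1/ d)) ℚₚ.≤-refl ⟩
  ⌜ b ℕ.* suc c ⌝ ℚ.* (1/ c ℚ.* 1/ d)           ≡⟨ cong (⌜ b ℕ.* suc c ⌝ ℚ.*_) (ℚₚ.*-comm (1/ c) (1/ d)) ⟩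
  ⌜ b ℕ.* suc c ⌝ ℚ.* (1/ d ℚ.* 1/ c)           ≡⟨ insert b d c ⟨
  ⌜ b ⌝ ℚ.* 1/ d                                ∎
  where
  open ℚₚ.≤-Reasoning
  shuffle : ∀ a d x y → a ℚ.* d ℚ.* (x ℚ.* y) ≡ a ℚ.* x ℚ.* (d ℚ.* y)
  shuffle = solve-∀-over ℚ-ring
  insert : ∀ a c d → ⌜ a ⌝ ℚ.* 1/ c ≡ ⌜ a ℕ.* suc d ⌝ ℚ.* (1/ c ℚ.* 1/ d)
  insert a c d = sym (trans (cong (ℚ._* (1/ c ℚ.* 1/ d)) (⌜⌝-* a (suc d)))
    (trans (shuffle ⌜ a ⌝ ⌜ suc d ⌝ (1/ c) (1/ d))
    (trans (cong (⌜ a ⌝ ℚ.* 1/ c ℚ.*_) (1/-inverse d)) (ℚₚ.*-identityʳ (⌜ a ⌝ ℚ.* 1/ c)))))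

-- exp (L/2) ≤ 2ᴸ
half-∈-log : ∀ {ξ : Real} {u} a c L → a ℕ.* 2 ℕ.≤ L ℕ.* suc c → ⌜ 2 ℕ.^ L ⌝ ℚ.≤ u → ξ u → log ξ (⌜ a ⌝ ℚ.* 1/ c)
half-∈-log {ξ} a c L a≤ 2ᴸ≤u = ∈-log {½} {⌜ 2 ⌝} (0≤1/ 1) (toWitness {a? = ½ ℚₚ.≤? 1ℚ} _) (0≤⌜⌝ 2) refl
  {ξ} L (/-mono-≤ a L c 1 a≤) (subst (ℚ._≤ _) (⌜⌝-^ 2 L) 2ᴸ≤u)

-- Lower bounds for log n and log log n

module _ {n} (3≤n : 3 ℕ.≤ n) where

  -- e^(21/20) ≤ (20/19)²¹ < 3
  small-∈-log : ∀ a c → a ℕ.* 20 ℕ.≤ 21 ℕ.* suc c → log (ιℕ n) (⌜ a ⌝ ℚ.* 1/ c)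
  small-∈-log a c a≤ = ∈-log {1/ 19} {+ 20 ℚ./ 19} (0≤1/ 19) (toWitness {a? = 1/ 19 ℚₚ.≤? 1ℚ} _)
    (toWitness {a? = 0ℚ ℚₚ.≤? (+ 20 ℚ./ 19)} _) refl {ιℕ n} 21 (/-mono-≤ a 21 c 19 a≤) ℚₚ.≤-refl
    (ℚₚ.<-≤-trans (toWitness {a? = (+ 20 ℚ./ 19) ^ 21 ℚₚ.<? ⌜ 3 ⌝} _) (⌜⌝-mono-≤ 3≤n))

  -- e^(1/21) ≤ 21/20
  small-∈-loglog : ∀ a c → a ℕ.* 21 ℕ.≤ 1 ℕ.* suc c → log (log (ιℕ n)) (⌜ a ⌝ ℚ.* 1/ c)
  small-∈-loglog a c a≤ = ∈-log {1/ 20} {+ 21 ℚ./ 20} (0≤1/ 20) (toWitness {a? = 1/ 20 ℚₚ.≤? 1ℚ} _)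
    (toWitness {a? = 0ℚ ℚₚ.≤? (+ 21 ℚ./ 20)} _) refl {log (ιℕ n)} 1 (/-mono-≤ a 1 c 20 a≤)
    (ℚₚ.≤-reflexive refl) (small-∈-log 21 19 ℕₚ.≤-refl)

  module _ (x : ℕ) (large : ∀ j → x ≡ suc j → 2 ℕ.^ (x ℕ.* 2 ℕ.^ x) ℕ.< n) where

    -- For `x ≥ 1`, `large` gives log n > x 2ˣ / 2, and (x + 1) 2ˣ⁺¹ is at most four times x 2ˣ. For
    -- `x = 0` it says nothing, and only `3 ≤ n` is left.
    λ-∈-log : log (ιℕ n) (⌜ 2 ℕ.^ suc x ℕ.* suc x ⌝ ℚ.* 1/ 41)
    λ-∈-log = go x large
      where
      go : ∀ x → (∀ j → x ≡ suc j → 2 ℕ.^ (x ℕ.* 2 ℕ.^ x) ℕ.< n) →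
           log (ιℕ n) (⌜ 2 ℕ.^ suc x ℕ.* suc x ⌝ ℚ.* 1/ 41)
      go zero    _     = small-∈-log 2 41 (toWitness {a? = 40 ℕₚ.≤? 882} _)
      go (suc j) large = half-∈-log {ιℕ n} (2 ℕ.^ suc (suc j) ℕ.* suc (suc j)) 41 (suc j ℕ.* 2 ℕ.^ suc j)
        (subst₂ ℕ._≤_ (sym (eq₁ j (2 ℕ.^ j))) (sym (eq₂ j (2 ℕ.^ j))) (ℕₚ.m≤m+n _ _))
        ℚₚ.≤-refl (⌜⌝-mono-< (large j refl))
        where
        eq₁ : ∀ j w → 2 ℕ.* (2 ℕ.* w) ℕ.* suc (suc j) ℕ.* 2 ≡ 16 ℕ.* w ℕ.+ 8 ℕ.* (j ℕ.* w)
        eq₁ = solve-∀ℕ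
        eq₂ : ∀ j w → suc j ℕ.* (2 ℕ.* w) ℕ.* 42 ≡
          16 ℕ.* w ℕ.+ 8 ℕ.* (j ℕ.* w) ℕ.+ (68 ℕ.* w ℕ.+ 76 ℕ.* (j ℕ.* w))
        eq₂ = solve-∀ℕ

    μ-∈-loglog : log (log (ιℕ n)) (⌜ suc x ⌝ ℚ.* 1/ 41)
    μ-∈-loglog = go x large
      where
      go : ∀ x → (∀ j → x ≡ suc j → 2 ℕ.^ (x ℕ.* 2 ℕ.^ x) ℕ.< n) → log (log (ιℕ n)) (⌜ suc x ⌝ ℚ.* 1/ 41)
      go zero          _     = small-∈-loglog 1 41 (toWitness {a? = 21 ℕₚ.≤? 42} _)
      -- Here 2/42 meets the bound 1/21 with equality.
      go (suc zero)    _     = small-∈-loglog 2 41 (toWitness {a? = 42 ℕₚ.≤? 42} _)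
      -- `L / 2` is in the cut of log n and is at least 2 ^ (z + 1), so log log n exceeds (z + 1)/2.
      -- At `x = 1` the same argument would yield only 0, hence the separate case.
      go (suc (suc z)) large = half-∈-log {log (ιℕ n)} {⌜ L ⌝ ℚ.* ½} (suc (suc (suc z))) 41 (suc z)
        (subst₂ ℕ._≤_ (sym (eq₁ z)) (sym (eq₂ z)) (ℕₚ.m≤m+n _ _))
        (subst (ℚ._≤ ⌜ L ⌝ ℚ.* ½) (ℚₚ.*-identityʳ ⌜ 2 ℕ.^ suc z ⌝) (/-mono-≤ (2 ℕ.^ suc z) L 0 1
          (subst₂ ℕ._≤_ (sym (eq₃ (2 ℕ.^ z))) (sym (eq₄ z (2 ℕ.^ z))) (ℕₚ.m≤m+n _ _))))
        (half-∈-log {ιℕ n} L 1 L ℕₚ.≤-refl ℚₚ.≤-refl (⌜⌝-mono-< (large (suc z) refl)))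
        where
        L : ℕ
        L = suc (suc z) ℕ.* 2 ℕ.^ suc (suc z)
        eq₁ : ∀ z → suc (suc (suc z)) ℕ.* 2 ≡ 6 ℕ.+ 2 ℕ.* z
        eq₁ = solve-∀ℕ
        eq₂ : ∀ z → suc z ℕ.* 42 ≡ 6 ℕ.+ 2 ℕ.* z ℕ.+ (36 ℕ.+ 40 ℕ.* z)
        eq₂ = solve-∀ℕ
        eq₃ : ∀ w → 2 ℕ.* w ℕ.* 2 ≡ 4 ℕ.* w
        eq₃ = solve-∀ℕ
        eq₄ : ∀ z w → suc (suc z) ℕ.* (2 ℕ.* (2 ℕ.* w)) ℕ.* 1 ≡ 4 ℕ.* w ℕ.+ (4 ℕ.* w ℕ.+ 4 ℕ.* (z ℕ.* w))
        eq₄ = solve-∀ℕ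

-- Choice of the parameters

1≤n*ε : ∀ {ε} → 0ℚ ℚ.< ε → ∃[ n ] 1ℚ ℚ.≤ ⌜ n ⌝ ℚ.* ε
1≤n*ε {ε} 0<ε = ℚ.↧ₙ ε , (begin
  1ℚ                                      ≡⟨ 1/-inverse d ⟨
  ⌜ suc d ⌝ ℚ.* 1/ d                      ≤⟨ ℚₚ.*-monoˡ-≤-nonNeg ⌜ suc d ⌝ {{ℚ.nonNegative (0≤⌜⌝ (suc d))}} 1/≤ε ⟩
  ⌜ suc d ⌝ ℚ.* ε                         ∎)
  where
  open ℚₚ.≤-Reasoning
  d : ℕ
  d = ℚ.denominator-1 ε
  1≤↥ε : + 1 ℤ.≤ ℚ.↥ ε
  1≤↥ε = ℤₚ.i<j⇒suc[i]≤j (subst₂ ℤ._<_ (ℤₚ.*-zeroˡ (ℚ.↧ ε)) (ℤₚ.*-identityʳ (ℚ.↥ ε)) (ℚₚ.drop-*<* 0<ε))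
  1/≤ε : 1/ d ℚ.≤ ε
  1/≤ε = subst (1/ d ℚ.≤_) (ℚₚ.↥p/↧p≡p ε)
    (fromℚᵘ-mono-≤ {mkℚᵘ (+ 1) d} {mkℚᵘ (ℚ.↥ ε) d} (*≤* (ℤₚ.*-monoʳ-≤-nonNeg (+ suc d) 1≤↥ε)))

-- Replaces the base of the rank bound by a power of `h`, hence of 2, at the price of a constant in
-- the exponent.
[h*h+h+1]≤h^4 : ∀ {h} → 2 ℕ.≤ h → suc (h ℕ.* suc h) ℕ.≤ h ℕ.^ 4
[h*h+h+1]≤h^4 {h} 2≤h = begin
  suc (h ℕ.* suc h)             ≤⟨ s≤s (ℕₚ.m≤n+m (h ℕ.* suc h) h) ⟩
  suc h ℕ.* suc h               ≤⟨ ℕₚ.*-mono-≤ 1+h≤h² 1+h≤h² ⟩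
  (h ℕ.* h) ℕ.* (h ℕ.* h)       ≡⟨ eq h ⟩
  h ℕ.^ 4                       ∎
  where
  open ℕₚ.≤-Reasoning
  eq : ∀ h → (h ℕ.* h) ℕ.* (h ℕ.* h) ≡ h ℕ.* (h ℕ.* (h ℕ.* (h ℕ.* 1)))
  eq = solve-∀ℕ
  1+h≤h² : suc h ℕ.≤ h ℕ.* h
  1+h≤h² = begin
    1 ℕ.+ h         ≤⟨ ℕₚ.+-monoˡ-≤ h (ℕₚ.≤-trans (s≤s z≤n) 2≤h) ⟩
    h ℕ.+ h         ≡⟨ cong (h ℕ.+_) (ℕₚ.+-identityʳ h) ⟨
    2 ℕ.* h         ≤⟨ ℕₚ.*-monoˡ-≤ h 2≤h ⟩
    h ℕ.* h         ∎

m*n≤h : ∀ {m n h} → m ℕ.* m ℕ.≤ h → n ℕ.* n ℕ.≤ h → m ℕ.* n ℕ.≤ h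
m*n≤h {m} {n} m²≤h n²≤h with ℕₚ.≤-total m n
... | inj₁ m≤n = ℕₚ.≤-trans (ℕₚ.*-monoˡ-≤ n m≤n) n²≤h
... | inj₂ n≤m = ℕₚ.≤-trans (ℕₚ.*-monoʳ-≤ m n≤m) m²≤h

½^[1+n]≤½ : ∀ n → ½ ^ suc n ℚ.≤ ½
½^[1+n]≤½ n = ℚₚ.≤-trans
  (ℚₚ.*-monoˡ-≤-nonNeg ½ (^-≤1 n (0≤1/ 1) (toWitness {a? = ½ ℚₚ.≤? 1ℚ} _)))
  (ℚₚ.≤-reflexive (ℚₚ.*-identityʳ ½))

-- Used with `v = 84` and `w = 41`: the 84 cancels the 1/42 in `μ` and the ½ in `β`.
⌜scaled⌝ : ∀ η u q H v w → ⌜ v ⌝ ℚ.* (1/ w ℚ.* ½) ≡ 1ℚ →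
  ⌜ η ℕ.* u ℕ.* (q ℕ.* H) ⌝ ≡ ⌜ u ℕ.* v ℕ.* q ⌝ ℚ.* (⌜ H ⌝ ℚ.* (⌜ η ⌝ ℚ.* 1/ w ℚ.* ½))
⌜scaled⌝ η u q H v w v/w≡1 = begin
  ⌜ l ⌝                                     ≡⟨ ℚₚ.*-identityʳ ⌜ l ⌝ ⟨
  ⌜ l ⌝ ℚ.* 1ℚ                              ≡⟨ cong (⌜ l ⌝ ℚ.*_) v/w≡1 ⟨
  ⌜ l ⌝ ℚ.* (⌜ v ⌝ ℚ.* (1/ w ℚ.* ½))        ≡⟨ ℚₚ.*-assoc ⌜ l ⌝ ⌜ v ⌝ (1/ w ℚ.* ½) ⟨
  ⌜ l ⌝ ℚ.* ⌜ v ⌝ ℚ.* (1/ w ℚ.* ½)          ≡⟨ cong (ℚ._* (1/ w ℚ.* ½)) (⌜⌝-* l v) ⟨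
  ⌜ l ℕ.* v ⌝ ℚ.* (1/ w ℚ.* ½)              ≡⟨ cong (λ z → ⌜ z ⌝ ℚ.* (1/ w ℚ.* ½)) (eqℕ η u q H v) ⟩
  ⌜ s ℕ.* (H ℕ.* η) ⌝ ℚ.* (1/ w ℚ.* ½)
    ≡⟨ cong (ℚ._* (1/ w ℚ.* ½)) (trans (⌜⌝-* s (H ℕ.* η)) (cong (⌜ s ⌝ ℚ.*_) (⌜⌝-* H η))) ⟩
  ⌜ s ⌝ ℚ.* (⌜ H ⌝ ℚ.* ⌜ η ⌝) ℚ.* (1/ w ℚ.* ½)  ≡⟨ eqℚ ⌜ s ⌝ ⌜ H ⌝ ⌜ η ⌝ (1/ w) ½ ⟩
  ⌜ s ⌝ ℚ.* (⌜ H ⌝ ℚ.* (⌜ η ⌝ ℚ.* 1/ w ℚ.* ½))  ∎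
  where
  open ≡-Reasoning
  l s : ℕ
  l = η ℕ.* u ℕ.* (q ℕ.* H)
  s = u ℕ.* v ℕ.* q
  eqℕ : ∀ η u q H v → η ℕ.* u ℕ.* (q ℕ.* H) ℕ.* v ≡ u ℕ.* v ℕ.* q ℕ.* (H ℕ.* η)
  eqℕ = solve-∀ℕ
  eqℚ : ∀ a H η c d → a ℚ.* (H ℚ.* η) ℚ.* (c ℚ.* d) ≡ a ℚ.* (H ℚ.* (η ℚ.* c ℚ.* d))
  eqℚ = solve-∀-over ℚ-ring

module _ {m r′ : ℕ} (F : PrimeFactorization m (suc r′)) where
  private
    r : ℕ
    r = suc r′

  -- Chosen so that L = 4 η Q H equals S β, where β = η H / 84 (see Parameters).
  S : ℕ
  S = 4 ℕ.* 84 ℕ.* Q F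

  -- h = 2^η with η = x + 1 least such that n ≤ hʰ, and H is the integer part of ʳ√h.
  record Parameters (n : ℕ) : Set where
    field
      x H    : ℕ
      n≤     : n ℕ.≤ (2 ℕ.^ suc x) ℕ.^ (2 ℕ.^ suc x)
      large  : ∀ j → x ≡ suc j → 2 ℕ.^ (x ℕ.* 2 ℕ.^ x) ℕ.< n
      1≤H    : 1 ℕ.≤ H
      Hʳ≤    : H ℕ.^ r ℕ.≤ 2 ℕ.^ suc x
      <[1+H]ʳ : 2 ℕ.^ suc x ℕ.< suc H ℕ.^ r

    η h : ℕ
    η = suc x
    h = 2 ℕ.^ η

    kernel = codiagonalKernel F n≤ 1≤H <[1+H]ʳ

    t : ℕ
    t = length (proj₁ kernel)

    L : ℕ
    L = η ℕ.* 4 ℕ.* (Q F ℕ.* H)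

    1≤L : 1 ℕ.≤ L
    1≤L = ℕₚ.*-mono-≤ {1} {η ℕ.* 4} (s≤s z≤n) (ℕₚ.*-mono-≤ {1} {Q F} (s≤s z≤n) 1≤H)

    t≤2^L : t ℕ.≤ 2 ℕ.^ L
    t≤2^L = begin
      t                                       ≤⟨ proj₂ (proj₂ kernel) ⟩
      suc (h ℕ.* suc h) ℕ.^ (Q F ℕ.* H)       ≤⟨ ℕₚ.^-monoˡ-≤ (Q F ℕ.* H) ([h*h+h+1]≤h^4 2≤h) ⟩
      ((2 ℕ.^ η) ℕ.^ 4) ℕ.^ (Q F ℕ.* H)       ≡⟨ cong (ℕ._^ (Q F ℕ.* H)) (ℕₚ.^-*-assoc 2 η 4) ⟩
      (2 ℕ.^ (η ℕ.* 4)) ℕ.^ (Q F ℕ.* H)       ≡⟨ ℕₚ.^-*-assoc 2 (η ℕ.* 4) (Q F ℕ.* H) ⟩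
      2 ℕ.^ L                                 ∎
      where
      open ℕₚ.≤-Reasoning
      2≤h : 2 ℕ.≤ h
      2≤h = ℕₚ.*-monoʳ-≤ 2 (ℕₚ.m^n>0 2 x)

    B C : Matrix ℤ n t
    B i l = proj₂ (lookup (proj₁ kernel) l) i
    C i l = proj₁ (lookup (proj₁ kernel) l) i

    represents : Representation.IsMatrix1aStrongRep F (Representation.CBᵀXBCᵀ F n t B C) (Representation.X F n)
    represents = codiagonal⇒1aStrong F B C zero
      ( (λ i → trans (sym (⟦⟧-lookup E i i)) (proj₁ (proj₁ (proj₂ kernel)) i))
      , (λ i k i≢k → let (j , div) = proj₂ (proj₁ (proj₂ kernel)) i k i≢k in
           j , subst (+ (PrimeFactorization.p F j ℕ.^ PrimeFactorization.e F j) ℤ∣.∣_)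
              (⟦⟧-lookup E i k) div))
      where
      E : Kernel (Fin n)
      E = proj₁ kernel

    -- λ′ < log n, μ < log log n and β < ʳ√(log n · (log log n)ʳ⁻¹); the denominator 42 is
    -- dictated by n = 3, where log log n is about 0.094.
    μ λ′ β : ℚ
    μ  = ⌜ η ⌝ ℚ.* 1/ 41
    λ′ = ⌜ h ℕ.* η ⌝ ℚ.* 1/ 41
    β  = ⌜ H ⌝ ℚ.* (μ ℚ.* ½)

    0≤μ : 0ℚ ℚ.≤ μ
    0≤μ = 0≤* (0≤⌜⌝ η) (0≤1/ 41)

    0≤λ : 0ℚ ℚ.≤ λ′
    0≤λ = 0≤* (0≤⌜⌝ (h ℕ.* η)) (0≤1/ 41)

    0≤β : 0ℚ ℚ.≤ β
    0≤β = 0≤* (0≤⌜⌝ H) (0≤* 0≤μ (0≤1/ 1))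

    -- Hʳ ≤ h and `h μ = λ′`, which leaves `r - 1` factors `μ`. Of the `r` halves one is kept: it is
    -- the `δ < 1` that `∈-^ᴿ` requires.
    βʳ≤ : β ^ r ℚ.≤ λ′ ℚ.* (μ ^ r′ ℚ.* ½)
    βʳ≤ = begin
      β ^ r                                     ≡⟨ ^-distrib-* ⌜ H ⌝ (μ ℚ.* ½) r ⟩
      ⌜ H ⌝ ^ r ℚ.* (μ ℚ.* ½) ^ r               ≡⟨ cong₂ ℚ._*_ (sym (⌜⌝-^ H r)) (^-distrib-* μ ½ r) ⟩
      ⌜ H ℕ.^ r ⌝ ℚ.* (μ ^ r ℚ.* ½ ^ r)
        ≤⟨ *-mono-≤ (0≤⌜⌝ h) (⌜⌝-mono-≤ Hʳ≤) (0≤* (0≤^ r 0≤μ) (0≤^ r (0≤1/ 1)))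
             (*-mono-≤ (0≤^ r 0≤μ) ℚₚ.≤-refl (0≤^ r (0≤1/ 1)) (½^[1+n]≤½ r′)) ⟩
      ⌜ h ⌝ ℚ.* (⌜ η ⌝ ℚ.* 1/ 41 ℚ.* μ ^ r′ ℚ.* ½)  ≡⟨ eq ⌜ h ⌝ ⌜ η ⌝ (1/ 41) (μ ^ r′) ½ ⟩
      ⌜ h ⌝ ℚ.* ⌜ η ⌝ ℚ.* 1/ 41 ℚ.* (μ ^ r′ ℚ.* ½)
        ≡⟨ cong (λ z → z ℚ.* 1/ 41 ℚ.* (μ ^ r′ ℚ.* ½)) (⌜⌝-* h η) ⟨
      λ′ ℚ.* (μ ^ r′ ℚ.* ½)                     ∎
      where
      open ℚₚ.≤-Reasoning
      eq : ∀ h η c w d → h ℚ.* (η ℚ.* c ℚ.* w ℚ.* d) ≡ h ℚ.* η ℚ.* c ℚ.* (w ℚ.* d)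
      eq = solve-∀-over ℚ-ring

    L≡ : ⌜ L ⌝ ≡ ⌜ S ⌝ ℚ.* β
    L≡ = ⌜scaled⌝ η 4 (Q F) H 84 41 refl

    -- The constant is `S + 1` because the open cut of the constant must contain `S`; then `L = S β`
    -- is a product of members of the two cuts.
    t≤bound : 3 ℕ.≤ n → ιℕ t ≤ᴿ bound (⌜ S ⌝ ℚ.+ 1ℚ) r n
    t≤bound 3≤n = ≤-exp {ξ = ι _ · root r (log (ιℕ n) · log (log (ιℕ n)) ^ᴿ r′)} 1≤L t≤2^L (inj₂
      ( ⌜ S ⌝ , β , 0≤⌜⌝ S
      , subst (ℚ._< ⌜ S ⌝ ℚ.+ 1ℚ) (ℚₚ.+-identityʳ ⌜ S ⌝)
          (ℚₚ.+-monoʳ-< ⌜ S ⌝ (⌜⌝-mono-< {0} {1} (s≤s z≤n)))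
      , 0≤β
      , inj₂ (inj₂ (λ′ , μ ^ r′ ℚ.* ½ , 0≤λ , λ-∈-log 3≤n x large , 0≤* (0≤^ r′ 0≤μ) (0≤1/ 1)
          , ∈-^ᴿ {log (log (ιℕ n))} 0≤μ (μ-∈-loglog 3≤n x large) (0≤1/ 1) (toWitness {a? = ½ ℚₚ.<? 1ℚ} _) r′
          , βʳ≤))
      , ℚₚ.≤-reflexive L≡ ))

    -- M ≥ 1/ε and H ≤ √h give S M H ≤ h, hence L ≤ (ε/2) λ′.
    t≤n^ε : 3 ℕ.≤ n → 2 ℕ.≤ r → ∀ {ε} → 0ℚ ℚ.< ε → ∀ M → 1ℚ ℚ.≤ ⌜ M ⌝ ℚ.* ε →
      (S ℕ.* M) ℕ.* (S ℕ.* M) ℕ.≤ h → ιℕ t ≤ᴿ exp (ι ε · log (ιℕ n))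
    t≤n^ε 3≤n 2≤r {ε} 0<ε M 1≤Mε W²≤h = ≤-exp {ξ = ι ε · log (ιℕ n)} 1≤L t≤2^L (inj₂
      ( ε ℚ.* ½ , λ′ , 0≤* (ℚₚ.<⇒≤ 0<ε) (0≤1/ 1)
      , subst (ε ℚ.* ½ ℚ.<_) (ℚₚ.*-identityʳ ε)
          (ℚₚ.*-monoʳ-<-pos ε {{ℚ.positive 0<ε}} (toWitness {a? = ½ ℚₚ.<? 1ℚ} _))
      , 0≤λ , λ-∈-log 3≤n x large , L≤ ))
      where
      open ℚₚ.≤-Reasoning
      W : ℕ
      W = S ℕ.* M
      H²≤h : H ℕ.* H ℕ.≤ h
      H²≤h = ℕₚ.≤-trans (ℕₚ.≤-reflexive (cong (H ℕ.*_) (sym (ℕₚ.*-identityʳ H))))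
        (ℕₚ.≤-trans (ℕₚ.^-monoʳ-≤ H {{ℕ.>-nonZero 1≤H}} 2≤r) Hʳ≤)
      WH≤h : W ℕ.* H ℕ.≤ h
      WH≤h = m*n≤h {W} {H} W²≤h H²≤h
      eqℕ : ∀ s m H η → s ℕ.* m ℕ.* H ℕ.* η ≡ m ℕ.* (s ℕ.* (H ℕ.* η))
      eqℕ = solve-∀ℕ
      group : ∀ a H η c d m ε → a ℚ.* (H ℚ.* (η ℚ.* c ℚ.* d)) ℚ.* (m ℚ.* ε) ≡
        ε ℚ.* d ℚ.* (m ℚ.* (a ℚ.* (H ℚ.* η)) ℚ.* c)
      group = solve-∀-over ℚ-ring
      L≤ : ⌜ L ⌝ ℚ.≤ ε ℚ.* ½ ℚ.* λ′
      L≤ = begin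
        ⌜ L ⌝                                                     ≡⟨ ℚₚ.*-identityʳ ⌜ L ⌝ ⟨
        ⌜ L ⌝ ℚ.* 1ℚ
          ≤⟨ ℚₚ.*-monoˡ-≤-nonNeg ⌜ L ⌝ {{ℚ.nonNegative (0≤⌜⌝ L)}} 1≤Mε ⟩
        ⌜ L ⌝ ℚ.* (⌜ M ⌝ ℚ.* ε)                                   ≡⟨ cong (ℚ._* (⌜ M ⌝ ℚ.* ε)) L≡ ⟩
        ⌜ S ⌝ ℚ.* β ℚ.* (⌜ M ⌝ ℚ.* ε)
          ≡⟨ group ⌜ S ⌝ ⌜ H ⌝ ⌜ η ⌝ (1/ 41) ½ ⌜ M ⌝ ε ⟩
        ε ℚ.* ½ ℚ.* (⌜ M ⌝ ℚ.* (⌜ S ⌝ ℚ.* (⌜ H ⌝ ℚ.* ⌜ η ⌝)) ℚ.* 1/ 41)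
          ≡⟨ cong (λ z → ε ℚ.* ½ ℚ.* (z ℚ.* 1/ 41)) collect ⟨
        ε ℚ.* ½ ℚ.* (⌜ W ℕ.* H ℕ.* η ⌝ ℚ.* 1/ 41)
          ≤⟨ ℚₚ.*-monoˡ-≤-nonNeg (ε ℚ.* ½) {{ℚ.nonNegative (0≤* (ℚₚ.<⇒≤ 0<ε) (0≤1/ 1))}}
               (ℚₚ.*-monoʳ-≤-nonNeg (1/ 41) (⌜⌝-mono-≤ (ℕₚ.*-monoˡ-≤ η WH≤h))) ⟩
        ε ℚ.* ½ ℚ.* λ′                                            ∎
        where
        collect : ⌜ W ℕ.* H ℕ.* η ⌝ ≡ ⌜ M ⌝ ℚ.* (⌜ S ⌝ ℚ.* (⌜ H ⌝ ℚ.* ⌜ η ⌝))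
        collect = trans (cong ⌜_⌝ (eqℕ S M H η)) (trans (⌜⌝-* M _) (cong (⌜ M ⌝ ℚ.*_)
          (trans (⌜⌝-* S (H ℕ.* η)) (cong (⌜ S ⌝ ℚ.*_) (⌜⌝-* H η)))))

  parameters : ∀ n → Parameters n
  parameters n with boundary (λ x → n ℕₚ.≤? (2 ℕ.^ suc x) ℕ.^ (2 ℕ.^ suc x)) n enough
    where
    open ℕₚ.≤-Reasoning
    enough : n ℕ.≤ (2 ℕ.^ suc n) ℕ.^ (2 ℕ.^ suc n)
    enough = begin
      n                                     ≤⟨ ℕₚ.n≤1+n n ⟩
      suc n                                 ≤⟨ ℕₚ.<⇒≤ (n<b^n ℕₚ.≤-refl (suc n)) ⟩
      2 ℕ.^ suc n                           ≡⟨ ℕₚ.*-identityʳ (2 ℕ.^ suc n) ⟨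
      (2 ℕ.^ suc n) ℕ.^ 1
        ≤⟨ ℕₚ.^-monoʳ-≤ (2 ℕ.^ suc n) {{ℕₚ.m^n≢0 2 (suc n)}} (ℕₚ.m^n>0 2 (suc n)) ⟩
      (2 ℕ.^ suc n) ℕ.^ (2 ℕ.^ suc n)       ∎
  ... | x , n≤ , below with floorRoot r {2 ℕ.^ suc x} (s≤s z≤n) (ℕₚ.m^n>0 2 (suc x))
  ...   | H , 1≤H , Hʳ≤ , <[1+H]ʳ = record
    { x = x ; H = H ; n≤ = n≤ ; 1≤H = 1≤H ; Hʳ≤ = Hʳ≤ ; <[1+H]ʳ = <[1+H]ʳ
    ; large = λ { j refl → subst (ℕ._< n) (ℕₚ.^-*-assoc 2 (suc j) (2 ℕ.^ suc j)) (ℕₚ.≰⇒> (below j refl)) }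
    }

  dimension : ℕ → ℕ
  dimension n = Parameters.t (parameters n)

  -- Either `z ≤ η < 2 ^ η = h`, or `η ≤ z`, and then `n ≤ hʰ` contradicts the size of `n`.
  h-unbounded : ∀ z n → (2 ℕ.^ z) ℕ.^ (2 ℕ.^ z) ℕ.< n → z ℕ.≤ Parameters.h (parameters n)
  h-unbounded z n <n with ℕₚ.≤-total z (Parameters.η (parameters n))
  ... | inj₁ z≤η = ℕₚ.≤-trans z≤η (ℕₚ.<⇒≤ (n<b^n ℕₚ.≤-refl (Parameters.η (parameters n))))
  ... | inj₂ η≤z = contradiction n≤[2^z]^[2^z] (ℕₚ.<⇒≱ <n)
    where
    open ℕₚ.≤-Reasoning
    open Parameters (parameters n)
    h≤ : h ℕ.≤ 2 ℕ.^ z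
    h≤ = ℕₚ.^-monoʳ-≤ 2 η≤z
    n≤[2^z]^[2^z] : n ℕ.≤ (2 ℕ.^ z) ℕ.^ (2 ℕ.^ z)
    n≤[2^z]^[2^z] = begin
      n                                 ≤⟨ n≤ ⟩
      h ℕ.^ h                           ≤⟨ ℕₚ.^-monoʳ-≤ h {{ℕₚ.m^n≢0 2 η}} h≤ ⟩
      h ℕ.^ (2 ℕ.^ z)                   ≤⟨ ℕₚ.^-monoˡ-≤ (2 ℕ.^ z) h≤ ⟩
      (2 ℕ.^ z) ℕ.^ (2 ℕ.^ z)           ∎

  dimension-eventually-≤ : 2 ℕ.≤ r → ∀ {ε} → 0ℚ ℚ.< ε → ∀ M → 1ℚ ℚ.≤ ⌜ M ⌝ ℚ.* ε →
    ∀ z → (S ℕ.* M) ℕ.* (S ℕ.* M) ℕ.≤ z →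
    ∃[ N ] (∀ n → N ℕ.≤ n → ιℕ (dimension n) ≤ᴿ exp (ι ε · log (ιℕ n)))
  -- The 3 serves twice: it gives `3 ≤ n` and makes the inequality wanted by `h-unbounded` strict.
  dimension-eventually-≤ 2≤r 0<ε M 1≤Mε z W²≤z = 3 ℕ.+ (2 ℕ.^ z) ℕ.^ (2 ℕ.^ z) , λ n N≤n →
    Parameters.t≤n^ε (parameters n) (ℕₚ.≤-trans (ℕₚ.m≤m+n 3 _) N≤n) 2≤r 0<ε M 1≤Mε
      (ℕₚ.≤-trans W²≤z (h-unbounded z n (ℕₚ.<-≤-trans (s≤s (ℕₚ.m≤n+m _ 2)) N≤n)))

  dimension-isSubpolynomial : 2 ℕ.≤ r → IsSubpolynomial dimension
  dimension-isSubpolynomial 2≤r ε 0<ε =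
    let (M , 1≤Mε) = 1≤n*ε 0<ε in
    dimension-eventually-≤ 2≤r 0<ε M 1≤Mε ((S ℕ.* M) ℕ.* (S ℕ.* M)) ℕₚ.≤-refl

theorem10 : (m : ℕ) → 1 < m → ¬ IsPrimePower m →
    (r : ℕ) → 2 ≤ r → (F : PrimeFactorization m r) →
    let open Representation F in
    Σ[ c ∈ ℚ ] 0ℚ ℚ.< c × (Σ[ t ∈ (ℕ → ℕ) ]
    (∀ n → 3 ≤ n →
    ιℕ (t n) ≤ᴿ bound c r n ×
    (Σ[ B ∈ Matrix ℤ n (t n) ] Σ[ C ∈ Matrix ℤ n (t n) ]
    IsMatrix1aStrongRep (CBᵀXBCᵀ n (t n) B C) (X n))) ×
    IsSubpolynomial t)
theorem10 m _ _ (suc r′) 2≤r F =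
  ⌜ S F ⌝ ℚ.+ 1ℚ ,
  ℚₚ.+-mono-≤-< (0≤⌜⌝ (S F)) (⌜⌝-mono-< {0} {1} (s≤s z≤n)) ,
  dimension F ,
  (λ n 3≤n → let open Parameters (parameters F n) in t≤bound 3≤n , B , C , represents) ,
  dimension-isSubpolynomial F 2≤r
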